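{- Let $G=(V,E)$ be a finite connected graph with girth at least $6$. Then $$\mathrm{DN}_{\mathrm{LLY}}(G)<\infty\quad\Longleftrightarrow\quad G\text{ is a tree or }G=C_n\text{ for some }n\ge6.$$ Consequently, if $|E|>|V|$ then $\mathrm{DN}_{\mathrm{LLY}}(G)=\infty$, while if $|E|=|V|$ then $\mathrm{DN}_{\mathrm{LLY}}(G)<\infty$ exactly when $G$ is a cycle $C_n$ with $n\ge6$.
   Context: Graphs are simple and undirected; $C_n$ is the cycle of length $n$; the girth of a forest is infinite. Let $d(\cdot,\cdot)$ be the combinatorial graph distance. For a positive edge weight $w:E\to(0,\infty)$ put $d_x^w:=\sum_{y\sim x}w_{xy}$. For $\alpha\in[0,1]$ let $\mu_x^{\alpha,w}$ be the probability measure with $\mu_x^{\alpha,w}(x)=\alpha$, $\mu_x^{\alpha,w}(z)=(1-\alpha)w_{xz}/d_x^w$ for $z\sim x$, and $0$ otherwise. Let $W_1$ be the $1$-Wasserstein distance with respect to $d$. For $x\sim y$ let $\kappa_\alpha^w(x,y):=1-W_1(\mu_x^{\alpha,w},\mu_y^{\alpha,w})$ and define the weighted Lin--Lu--Yau curvature $\kappa_{\mathrm{LLY}}^w(x,y):=\lim_{\alpha\to1^- }\kappa_\alpha^w(x,y)/(1-\alpha)$. For connected locally finite $G$ with $E\neq\varnothing$: $\mathrm{Dist}(w):=\sup_{e\in E}w_e/\inf_{e\in E}w_e$, with value $+\infty$ if the supremum is infinite or the infimum is $0$; a positive weight $w$ is admissible if $\kappa_{\mathrm{LLY}}^w(e)\ge0$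 for every $e\in E$; and $\mathrm{DN}_{\mathrm{LLY}}(G):=\inf\{\mathrm{Dist}(w): w \text{ admissible}\}$, with value $+\infty$ if no admissible weight has finite distortion. By convention $\mathrm{DN}_{\mathrm{LLY}}(K_1)=1$. -}

module Defs where

open import Algebra.Bundles using (CommutativeRing)
import Algebra.Properties.CommutativeMonoid.Sum as Sum
import Algebra.Properties.Monoid.Mult as Mult
open import Data.Bool using (if_then_else_)
open import Data.Empty using (⊥-elim)
open import Data.Fin using (Fin; toℕ)
open import Data.Fin.Properties as Fin using (any?)
open import Data.List using (List; allFin; cartesianProduct; filter; length)
open import Data.Nat as ℕ using (ℕ; zero; suc; z≤n; s≤s)
open import Data.Nat.Properties as ℕ using (1+n≢n; suc-injective)
open import Data.Product using (Σ-syntax; ∃; ∃-syntax; _×_; _,_; proj₁; proj₂)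
open import Data.Sum using (_⊎_; inj₁; inj₂; swap)
open import Function using (_∘_)
open import Function.Bundles using (_⇔_; _↔_; Inverse)
open import Function.Definitions using (Injective)
open import Level using (0ℓ)
open import Relation.Binary.Core using (Rel)
import Relation.Binary.Construct.Add.Supremum.NonStrict as AddSupremum
import Relation.Binary.Construct.NonStrictToStrict as ToStrict
open import Relation.Binary.Definitions as B using (Irreflexive; Symmetric)
open import Relation.Binary.PropositionalEquality
  using (_≡_; refl; sym; trans)
open import Relation.Binary.Structures using (IsDecTotalOrder)
open import Relation.Nullary using (¬_; does; yes; no)
open import Relation.Nullary.Construct.Add.Supremum using (_⁺; [_]; ⊤⁺)
open import Relation.Nullary.Decidable using (_×-dec_; _⊎-dec_)
open import Relation.Unary as U using (Pred)

module _ {A : Set} (_≤_ : Rel A 0ℓ) where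

  IsLUB : Pred A 0ℓ → A → Set
  IsLUB P s = (∀ x → P x → x ≤ s) × (∀ b → (∀ x → P x → x ≤ b) → s ≤ b)

  IsGLB : Pred A 0ℓ → A → Set
  IsGLB P i = (∀ x → P x → i ≤ x) × (∀ b → (∀ x → P x → b ≤ x) → b ≤ i)

-- The real numbers, given axiomatically as a Dedekind-complete totally ordered
-- field; classically this determines them up to unique isomorphism.  Equality
-- is the setoid equality _≈_, and the value of 0# ⁻¹ is unspecified.
record Reals : Set₁ where
  field
    commutativeRing : CommutativeRing 0ℓ 0ℓ

  open CommutativeRing commutativeRing public
    renaming (refl to ≈-refl; sym to ≈-sym; trans to ≈-trans)

  infix 4 _≤_ _<_
  infix 8 _⁻¹

  field
    _≤_             : Rel Carrier 0ℓ
    isDecTotalOrder : IsDecTotalOrder _≈_ _≤_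
    +-monoˡ-≤       : ∀ z {x y} → x ≤ y → x + z ≤ y + z
    *-nonneg        : ∀ {x y} → 0# ≤ x → 0# ≤ y → 0# ≤ x * y
    0≉1             : ¬ 0# ≈ 1#
    _⁻¹             : Carrier → Carrier
    ⁻¹-cong         : ∀ {x y} → x ≈ y → x ⁻¹ ≈ y ⁻¹
    *-inverseʳ      : ∀ x → ¬ x ≈ 0# → x * x ⁻¹ ≈ 1#
    complete        : (P : Pred Carrier 0ℓ) → ∃ P →
                      ∃[ b ] (∀ x → P x → x ≤ b) → ∃ (IsLUB _≤_ P)

  _<_ : Rel Carrier 0ℓ
  _<_ = ToStrict._<_ _≈_ _≤_

  open Sum +-commutativeMonoid public using (sum)
  open Mult +-monoid public renaming (_×_ to _·_) using ()
  open AddSupremum _≤_ public using (_≤⁺_)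

record Graph : Set₁ where
  field
    order    : ℕ

  Vertex : Set
  Vertex = Fin order

  infix 4 _~_

  field
    _~_      : Rel Vertex 0ℓ
    _~?_     : B.Decidable _~_
    ~-sym    : Symmetric _~_
    ~-irrefl : Irreflexive _≡_ _~_

  Walk : ℕ → Rel Vertex 0ℓ
  Walk zero    x y = x ≡ y
  Walk (suc k) x y = ∃[ z ] (x ~ z × Walk k z y)

  walk? : ∀ k → B.Decidable (Walk k)
  walk? zero    x y = x Fin.≟ y
  walk? (suc k) x y = any? λ z → (x ~? z) ×-dec walk? k z y

  -- Each undirected edge is listed once, with its smaller endpoint first.
  edges : List (Vertex × Vertex)
  edges = filter (λ (x , y) → (x Fin.<? y) ×-dec (x ~? y))
                 (cartesianProduct (allFin order) (allFin order))

∣V∣ ∣E∣ : Graph → ℕ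
∣V∣ G = Graph.order G
∣E∣ G = length (Graph.edges G)

record Connected (G : Graph) : Set where
  open Graph G
  field
    nonempty : Vertex
    walk     : ∀ x y → ∃[ k ] Walk k x y

infix 4 _≅_

_≅_ : Graph → Graph → Set
G ≅ H = Σ[ f ∈ G.Vertex ↔ H.Vertex ]
          (∀ x y → x G.~ y ⇔ (Inverse.to f x H.~ Inverse.to f y))
  where
  module G = Graph G
  module H = Graph H

Next : ∀ n → Rel (Fin n) 0ℓ
Next n i j = (toℕ j ≡ suc (toℕ i)) ⊎ (n ≡ suc (toℕ i) × toℕ j ≡ 0)

next? : ∀ n → B.Decidable (Next n)
next? n i j = (toℕ j ℕ.≟ suc (toℕ i)) ⊎-dec
              ((n ℕ.≟ suc (toℕ i)) ×-dec (toℕ j ℕ.≟ 0))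

next-irrefl : ∀ {n} → 3 ℕ.≤ n → ∀ {i} → ¬ Next n i i
next-irrefl 3≤n (inj₁ i≡1+i) = 1+n≢n (sym i≡1+i)
next-irrefl (s≤s (s≤s _)) (inj₂ (n≡1+i , i≡0))
  with () ← trans (suc-injective n≡1+i) i≡0

C : (n : ℕ) → 3 ℕ.≤ n → Graph
C n 3≤n = record
  { order    = n
  ; _~_      = λ i j → Next n i j ⊎ Next n j i
  ; _~?_     = λ i j → next? n i j ⊎-dec next? n j i
  ; ~-sym    = swap
  ; ~-irrefl = λ { refl (inj₁ p) → next-irrefl 3≤n p
                 ; refl (inj₂ p) → next-irrefl 3≤n p }
  }

IsCycleGraph : ℕ → Graph → Set
IsCycleGraph n G = Σ[ 3≤n ∈ 3 ℕ.≤ n ] G ≅ C n 3≤n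

-- A cycle of length n in G is a (not necessarily induced) copy of C n.
HasCycle : ℕ → Graph → Set
HasCycle n G = Σ[ 3≤n ∈ 3 ℕ.≤ n ] Σ[ f ∈ (Fin n → Vertex) ]
                 (Injective _≡_ _≡_ f × (∀ {i j} → Graph._~_ (C n 3≤n) i j → f i ~ f j))
  where open Graph G

-- Forests, having infinite girth, satisfy this for every g.
Girth≥ : ℕ → Graph → Set
Girth≥ g G = ∀ n → HasCycle n G → g ℕ.≤ n

IsTree : Graph → Set
IsTree G = Connected G × (∀ n → ¬ HasCycle n G)

least : {P : Pred ℕ 0ℓ} → U.Decidable P → ∀ n → P n →
        ∃[ k ] (P k × (∀ j → P j → k ℕ.≤ j))
least P? zero    p = zero , p , λ _ _ → z≤n
least P? (suc n) p with P? zero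
... | yes p₀ = zero , p₀ , λ _ _ → z≤n
... | no ¬p₀ with least (P? ∘ suc) n p
...   | k , pₖ , min = suc k , pₖ , λ where
          zero    q → ⊥-elim (¬p₀ q)
          (suc j) q → s≤s (min j q)

module _ (G : Graph) (conn : Connected G) where
  open Graph G

  dist : Vertex → Vertex → ℕ
  dist x y = let k , walk = Connected.walk conn x y in
    proj₁ (least (λ k → walk? k x y) k walk)

module _ (ℝ : Reals) (G : Graph) where
  open Reals ℝ
  open Graph G

  -- Only the values on adjacent pairs are meaningful; the others are ignored.
  record Weight : Set where
    field
      w        : Vertex → Vertex → Carrier
      w-sym    : ∀ {x y} → x ~ y → w x y ≈ w y x
      positive : ∀ {x y} → x ~ y → 0# < w x y

  module _ (𝓌 : Weight) where
    open Weight 𝓌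

    degree : Vertex → Carrier
    degree x = sum λ y → if does (x ~? y) then w x y else 0#

    μ : Carrier → Vertex → Vertex → Carrier
    μ α x z =
      if does (z Fin.≟ x) then α
      else if does (x ~? z) then (1# - α) * (w x z * degree x ⁻¹)
      else 0#

    EdgeWeight : Pred Carrier 0ℓ
    EdgeWeight r = ∃[ x ] ∃[ y ] (x ~ y × r ≈ w x y)

    data IsDistortion : Pred (Carrier ⁺) 0ℓ where
      finite    : ∀ {s i} → IsLUB _≤_ EdgeWeight s → IsGLB _≤_ EdgeWeight i →
                  0# < i → IsDistortion [ s * i ⁻¹ ]
      unbounded : ¬ (∃[ b ] (∀ r → EdgeWeight r → r ≤ b)) → IsDistortion ⊤⁺
      inf≈0     : ∀ {i} → IsGLB _≤_ EdgeWeight i → i ≈ 0# → IsDistortion ⊤⁺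

  record IsCoupling (μ₁ μ₂ : Vertex → Carrier)
                    (π : Vertex → Vertex → Carrier) : Set where
    field
      nonneg    : ∀ x y → 0# ≤ π x y
      marginal₁ : ∀ x → sum (λ y → π x y) ≈ μ₁ x
      marginal₂ : ∀ y → sum (λ x → π x y) ≈ μ₂ y

-- W₁, the curvatures and DN are infima or limits of reals, hence are given by
-- their graphs: IsW₁ μ₁ μ₂ r says that the value exists and equals r, and
-- likewise for the others.
module _ (ℝ : Reals) (G : Graph) (conn : Connected G) where
  open Reals ℝ
  open Graph G

  cost : (Vertex → Vertex → Carrier) → Carrier
  cost π = sum λ x → sum λ y → dist G conn x y · π x y

  IsW₁ : (μ₁ μ₂ : Vertex → Carrier) → Pred Carrier 0ℓ
  IsW₁ μ₁ μ₂ = IsGLB _≤_ λ r → ∃[ π ] (IsCoupling ℝ G μ₁ μ₂ π × r ≈ cost π)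

  Isκ : Weight ℝ G → (α : Carrier) (x y : Vertex) → Pred Carrier 0ℓ
  Isκ w α x y k =
    ∃[ r ] (IsW₁ (μ ℝ G w α x) (μ ℝ G w α y) r × k ≈ 1# - r)

  -- The limit of κ_α / (1 - α) as α → 1 from below; α ranges over [0,1).
  IsκLLY : Weight ℝ G → (x y : Vertex) → Pred Carrier 0ℓ
  IsκLLY w x y l =
    ∀ ε → 0# < ε → ∃[ δ ] (0# < δ ×
      (∀ α → 0# ≤ α → α < 1# → 1# - δ < α →
        ∃[ k ] (Isκ w α x y k ×
                k * (1# - α) ⁻¹ - l < ε × l - k * (1# - α) ⁻¹ < ε)))

  Admissible : Weight ℝ G → Set
  Admissible w = ∀ x y → x ~ y → ∃[ l ] (IsκLLY w x y l × 0# ≤ l)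

  -- A connected graph has no edge exactly when it is K₁, where the value is 1
  -- by convention.  Otherwise the infimum is taken in the extended reals, so it
  -- is ⊤⁺ when no admissible weight has finite distortion.
  data IsDN : Pred (Carrier ⁺) 0ℓ where
    K₁       : ∣V∣ G ≡ 1 → IsDN [ 1# ]
    nonempty : ∀ {v} → ∃[ x ] ∃[ y ] x ~ y →
               IsGLB _≤⁺_ (λ u → ∃[ w ] (Admissible w × IsDistortion ℝ G w u)) v →
               IsDN v

  DN<∞ : Set
  DN<∞ = ∃[ r ] IsDN [ r ]

  DN≡∞ : Set
  DN≡∞ = IsDN ⊤⁺

{-# OPTIONS --safe #-}

-- Write p x y = w x y / degree x.  In a graph of girth at least 6 an explicit
-- optimal transport plan and an explicit Kantorovich potential give
-- κ(x, y) = 2 (p x y + p y x - 1), so a weight is admissible exactly when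
-- p x y + p y x ≥ 1 on every edge.
--
-- Then p x y ≥ 1 - p y x ≥ p y z for consecutive edges, with strict inequality if
-- y has a third neighbour; going once around a cycle shows that its vertices have
-- degree 2, so by connectedness it is the whole graph.  Conversely, constant
-- weights are admissible on cycles, and weights decaying doubly exponentially with
-- the distance from a root are admissible on trees, even with p x y + p y x > 1.
-- Summing p x y + p y x over all edges gives |V|, which compares |E| and |V|.

module Submission where

open import Algebra.Bundles using (CommutativeRing)
import Algebra.Properties.Monoid.Mult as MonoidMult
import Algebra.Properties.Ring as RingProperties
import Algebra.Properties.Semiring.Mult.TCOptimised as SemiringMult
import Algebra.Properties.Semiring.Sum as SemiringSum
import Algebra.Solver.Ring as RingSolver
open import Algebra.Solver.Ring.AlmostCommutativeRing
  using (_-Raw-AlmostCommutative⟶_; fromCommutativeRing)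
open import Data.Bool using (if_then_else_)
open import Data.Empty using (⊥; ⊥-elim)
open import Data.Fin as Fin using (Fin; zero; suc; toℕ)
import Data.Fin.Induction as Fin
import Data.Fin.Properties as Fin
open import Data.Integer as ℤ using (ℤ; +_; -[1+_])
import Data.Integer.Properties as ℤ
open import Data.List as List using (List; []; _∷_; _++_)
open import Data.List.Relation.Unary.All using (_∷_)
open import Data.List.Relation.Unary.All.Properties using (all-filter)
import Data.Maybe as Maybe
open import Data.Nat as ℕ using (ℕ; zero; suc)
import Data.Nat.Properties as ℕ
open import Data.Product using (∃; ∃-syntax; _×_; _,_; proj₁; proj₂)
open import Data.Sum using (_⊎_; inj₁; inj₂)
open import Defs
open import Function using (_∘_)
open import Function.Bundles using (_⇔_; mk⇔; mk↔ₛ′; Equivalence; Inverse)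
open import Function.Definitions using (Injective)
open import Level using (0ℓ)
open import Relation.Binary.Bundles using (Poset)
import Relation.Binary.Construct.Add.Supremum.NonStrict as AddSupremum
import Relation.Binary.Construct.NonStrictToStrict as ToStrict
open import Relation.Binary.Definitions using (tri<; tri≈; tri>)
open import Relation.Binary.PropositionalEquality as ≡ using (_≡_; _≢_)
import Relation.Binary.Reasoning.PartialOrder as PosetReasoning
open import Relation.Binary.Structures using (IsDecTotalOrder)
open import Relation.Nullary using (¬_; Dec; does; yes; no)
open import Relation.Nullary.Construct.Add.Supremum using ([_]; ⊤⁺)
open import Relation.Nullary.Decidable
  using (map′; _×-dec_; _→-dec_; ¬?; dec⇒maybe; decidable-stable)
open import Relation.Unary using (Pred; Decidable)

-- The obstacle is that `IsDN` and `IsκLLY` are relations: a finite `DN` names an infimum, not a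
-- weight, and an admissible edge comes with some limit `l`, not with a formula. The two halves of
-- transport duality therefore serve different directions. The potential alone bounds every coupling
-- at every `α`, so any `l` is at most `2 (p x y + p y x - 1)`; the plan, available once `α ≥ 1/2`,
-- shows that this limit exists. Since the infimum yields an admissible weight only up to double
-- negation, the presence of a cycle is decided outright, and that a cycle absorbs all edges at its
-- vertices is proved as a decidable, hence stable, statement. In the curvature formula the girth
-- enters only through the potential: an edge along which it rose too steeply would close a
-- triangle, a square or a pentagon. The doubly exponential decay comes from clearing denominators:
-- `p x y + p y x > 1` compares the square of `w x y` with a product of the remaining weights at the
-- two ends. At the end nearer the root these are bounded only by a constant, so the weights one
-- level further out must be small against the square of the present one.

-- Ring identities, ordered fields and finite sums

-- The library's ring solver decides only as much as its coefficients do; integer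
-- coefficients make it complete for an abstract commutative ring.
module IntegerCoefficients {c ℓ} (R : CommutativeRing c ℓ) where
  open CommutativeRing R
  open RingProperties ring using (-‿involutive; -0#≈0#; -‿distribˡ-*; -‿distribʳ-*; -‿+-comm)
  open SemiringMult semiring using (1+×; ×-homo-+; ×1-homo-*) renaming (_×_ to _×′_)
  open import Relation.Binary.Reasoning.Setoid setoid

  -- With the optimised multiple, `1 ×′ 1#` is `1#` by definition, so `con (+ 1)` in a solver call
  -- matches a literal `1#` in the goal.
  ⟦_⟧ : ℤ → Carrier
  ⟦ + n ⟧      = n ×′ 1#
  ⟦ -[1+ n ] ⟧ = - (suc n ×′ 1#)

  neg-homo : ∀ i → ⟦ ℤ.- i ⟧ ≈ - ⟦ i ⟧
  neg-homo (+ zero)   = sym -0#≈0#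
  neg-homo (+ suc n)  = refl
  neg-homo -[1+ n ]   = sym (-‿involutive _)

  ⊖-homo : ∀ m n → ⟦ m ℤ.⊖ n ⟧ ≈ m ×′ 1# - n ×′ 1#
  ⊖-homo zero    zero    = sym (-‿inverseʳ 0#)
  ⊖-homo (suc m) zero    = sym (trans (+-congˡ -0#≈0#) (+-identityʳ _))
  ⊖-homo zero    (suc n) = sym (+-identityˡ _)
  ⊖-homo (suc m) (suc n) = begin
    ⟦ suc m ℤ.⊖ suc n ⟧                 ≡⟨ ≡.cong ⟦_⟧ (ℤ.[1+m]⊖[1+n]≡m⊖n m n) ⟩
    ⟦ m ℤ.⊖ n ⟧                         ≈⟨ ⊖-homo m n ⟩
    m ×′ 1# - n ×′ 1#                     ≈⟨ +-congʳ (+-identityʳ _) ⟨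
    m ×′ 1# + 0# - n ×′ 1#                ≈⟨ +-congʳ (+-congˡ (-‿inverseʳ 1#)) ⟨
    m ×′ 1# + (1# - 1#) - n ×′ 1#         ≈⟨ +-congʳ (+-assoc _ _ _) ⟨
    m ×′ 1# + 1# - 1# - n ×′ 1#           ≈⟨ +-assoc _ _ _ ⟩
    m ×′ 1# + 1# + (- 1# - n ×′ 1#)       ≈⟨ +-cong (+-comm _ _) (-‿+-comm 1# _) ⟩
    1# + m ×′ 1# - (1# + n ×′ 1#)         ≈⟨ +-cong (1+× m 1#) (-‿cong (1+× n 1#)) ⟨
    suc m ×′ 1# - suc n ×′ 1#             ∎

  +-homo : ∀ i j → ⟦ i ℤ.+ j ⟧ ≈ ⟦ i ⟧ + ⟦ j ⟧
  +-homo (+ m)    (+ n)    = ×-homo-+ 1# m n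
  +-homo (+ m)    -[1+ n ] = ⊖-homo m (suc n)
  +-homo -[1+ m ] (+ n)    = trans (⊖-homo n (suc m)) (+-comm _ _)
  +-homo -[1+ m ] -[1+ n ] = begin
    - (suc (suc (m ℕ.+ n)) ×′ 1#)        ≡⟨ ≡.cong (λ k → - (suc k ×′ 1#)) (ℕ.+-suc m n) ⟨
    - ((suc m ℕ.+ suc n) ×′ 1#)          ≈⟨ -‿cong (×-homo-+ 1# (suc m) (suc n)) ⟩
    - (suc m ×′ 1# + suc n ×′ 1#)         ≈⟨ -‿+-comm _ _ ⟨
    - (suc m ×′ 1#) - suc n ×′ 1#         ∎

  *-homo⁺ : ∀ m j → ⟦ + m ℤ.* j ⟧ ≈ ⟦ + m ⟧ * ⟦ j ⟧
  *-homo⁺ m (+ n)    = begin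
    ⟦ + m ℤ.* + n ⟧      ≡⟨ ≡.cong ⟦_⟧ (ℤ.pos-* m n) ⟨
    (m ℕ.* n) ×′ 1#       ≈⟨ ×1-homo-* m n ⟩
    m ×′ 1# * n ×′ 1#      ∎
  *-homo⁺ m -[1+ n ] = begin
    ⟦ + m ℤ.* -[1+ n ] ⟧           ≡⟨ ≡.cong ⟦_⟧ (ℤ.neg-distribʳ-* (+ m) (+ suc n)) ⟨
    ⟦ ℤ.- (+ m ℤ.* + suc n) ⟧      ≈⟨ neg-homo (+ m ℤ.* + suc n) ⟩
    - ⟦ + m ℤ.* + suc n ⟧          ≈⟨ -‿cong (*-homo⁺ m (+ suc n)) ⟩
    - (m ×′ 1# * suc n ×′ 1#)        ≈⟨ -‿distribʳ-* _ _ ⟩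
    m ×′ 1# * - (suc n ×′ 1#)        ∎

  *-homo : ∀ i j → ⟦ i ℤ.* j ⟧ ≈ ⟦ i ⟧ * ⟦ j ⟧
  *-homo (+ m)    j = *-homo⁺ m j
  *-homo -[1+ m ] j = begin
    ⟦ -[1+ m ] ℤ.* j ⟧             ≡⟨ ≡.cong ⟦_⟧ (ℤ.neg-distribˡ-* (+ suc m) j) ⟨
    ⟦ ℤ.- (+ suc m ℤ.* j) ⟧        ≈⟨ neg-homo (+ suc m ℤ.* j) ⟩
    - ⟦ + suc m ℤ.* j ⟧            ≈⟨ -‿cong (*-homo⁺ (suc m) j) ⟩
    - (suc m ×′ 1# * ⟦ j ⟧)         ≈⟨ -‿distribˡ-* _ _ ⟩
    - (suc m ×′ 1#) * ⟦ j ⟧         ∎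

  morphism : ℤ.+-*-rawRing -Raw-AlmostCommutative⟶ fromCommutativeRing R
  morphism = record
    { ⟦_⟧    = ⟦_⟧
    ; +-homo = +-homo
    ; *-homo = *-homo
    ; -‿homo = neg-homo
    ; 0-homo = refl
    ; 1-homo = refl
    }

  open RingSolver ℤ.+-*-rawRing (fromCommutativeRing R) morphism
    (λ i j → Maybe.map (λ i≡j → reflexive (≡.cong ⟦_⟧ i≡j)) (dec⇒maybe (i ℤ.≟ j)))
    public using (solve; _:+_; _:*_; _:-_; :-_; con; _:=_)

module OrderedField (ℝ : Reals) where
  open Reals ℝ hiding (zero)
  open IntegerCoefficients commutativeRing public
    using (solve; _:+_; _:*_; _:-_; :-_; con; _:=_)
  open SemiringSum semiring public
    using (sum-cong-≋; ∑-distrib-+; ∑-comm; *-distribˡ-sum)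
  open MonoidMult +-monoid public using (×-congʳ; ×-homo-+)
  open IsDecTotalOrder isDecTotalOrder public
    using (isPartialOrder; _≤?_)
    renaming (refl to ≤-refl; trans to ≤-trans; antisym to ≤-antisym;
              total to ≤-total; reflexive to ≤-reflexive)

  poset : Poset 0ℓ 0ℓ 0ℓ
  poset = record { isPartialOrder = isPartialOrder }

  module ≤-Reasoning = PosetReasoning poset

  <⇒≤ : ∀ {x y} → x < y → x ≤ y
  <⇒≤ = proj₁

  <⇒≱ : ∀ {x y} → x < y → ¬ y ≤ x
  <⇒≱ = ToStrict.<⇒≱ _≈_ _≤_ ≤-antisym

  ≰⇒> : ∀ {x y} → ¬ x ≤ y → y < x
  ≰⇒> = ToStrict.≰⇒> _≈_ _≤_ ≈-sym ≤-reflexive ≤-total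

  <-≤-trans : ∀ {x y z} → x < y → y ≤ z → x < z
  <-≤-trans = ToStrict.<-≤-trans _≈_ _≤_ ≈-sym ≤-trans ≤-antisym
    (λ y≈z x≤y → ≤-trans x≤y (≤-reflexive y≈z))

  <-respʳ-≈ : ∀ {x y z} → y ≈ z → x < y → x < z
  <-respʳ-≈ y≈z x<y = <-≤-trans x<y (≤-reflexive y≈z)

  -- Most inequalities below are proved by naming the difference as a term known to be nonnegative;
  -- what remains is a ring identity for the solver.
  ≤-by : ∀ {x y e} → 0# ≤ e → y ≈ x + e → x ≤ y
  ≤-by {x} {y} {e} 0≤e y≈x+e = begin
    x        ≈⟨ +-identityˡ x ⟨
    0# + x   ≤⟨ +-monoˡ-≤ x 0≤e ⟩
    e + x    ≈⟨ +-comm e x ⟩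
    x + e    ≈⟨ y≈x+e ⟨
    y        ∎
    where open ≤-Reasoning

  x≤y⇒0≤y-x : ∀ {x y} → x ≤ y → 0# ≤ y - x
  x≤y⇒0≤y-x {x} {y} x≤y = begin
    0#       ≈⟨ -‿inverseʳ x ⟨
    x - x    ≤⟨ +-monoˡ-≤ (- x) x≤y ⟩
    y - x    ∎
    where open ≤-Reasoning

  x<y⇒0<y-x : ∀ {x y} → x < y → 0# < y - x
  x<y⇒0<y-x {x} {y} x<y = ≰⇒> λ y-x≤0 → <⇒≱ x<y
    (≤-by (x≤y⇒0≤y-x y-x≤0) (solve 2 (λ x y → x := y :+ (con (+ 0) :- (y :- x))) ≈-refl x y))

  <-by : ∀ {x y e} → 0# < e → y ≈ x + e → x < y
  <-by {x} {y} {e} 0<e y≈x+e = ≰⇒> λ y≤x → <⇒≱ 0<e (≤-by (x≤y⇒0≤y-x y≤x) (begin-equality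
    0#                ≈⟨ solve 2 (λ e x → con (+ 0) := e :+ (x :- (x :+ e))) ≈-refl e x ⟩
    e + (x - (x + e)) ≈⟨ +-congˡ (+-congˡ (-‿cong y≈x+e)) ⟨
    e + (x - y)       ∎))
    where open ≤-Reasoning

  +-mono-≤ : ∀ {x y u v} → x ≤ y → u ≤ v → x + u ≤ y + v
  +-mono-≤ {x} {y} {u} {v} x≤y u≤v = begin
    x + u  ≤⟨ +-monoˡ-≤ u x≤y ⟩
    y + u  ≈⟨ +-comm y u ⟩
    u + y  ≤⟨ +-monoˡ-≤ y u≤v ⟩
    v + y  ≈⟨ +-comm v y ⟩
    y + v  ∎
    where open ≤-Reasoning

  +-nonneg : ∀ {x y} → 0# ≤ x → 0# ≤ y → 0# ≤ x + y
  +-nonneg 0≤x 0≤y = ≤-trans 0≤x (≤-by 0≤y ≈-refl)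

  +-pos-nonneg : ∀ {x y} → 0# < x → 0# ≤ y → 0# < x + y
  +-pos-nonneg 0<x 0≤y = <-≤-trans 0<x (≤-by 0≤y ≈-refl)

  +-cancelʳ-≤ : ∀ {a b} c → a + c ≤ b + c → a ≤ b
  +-cancelʳ-≤ {a} {b} c a+c≤b+c = ≤-by (x≤y⇒0≤y-x a+c≤b+c)
    (solve 3 (λ a b c → b := a :+ ((b :+ c) :- (a :+ c))) ≈-refl a b c)

  *-monoˡ-≤ : ∀ z {x y} → 0# ≤ z → x ≤ y → z * x ≤ z * y
  *-monoˡ-≤ z {x} {y} 0≤z x≤y = ≤-by (*-nonneg 0≤z (x≤y⇒0≤y-x x≤y))
    (solve 3 (λ x y z → z :* y := z :* x :+ z :* (y :- x)) ≈-refl x y z)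

  *-monoʳ-≤ : ∀ z {x y} → 0# ≤ z → x ≤ y → x * z ≤ y * z
  *-monoʳ-≤ z {x} {y} 0≤z x≤y = ≤-by (*-nonneg 0≤z (x≤y⇒0≤y-x x≤y))
    (solve 3 (λ x y z → y :* z := x :* z :+ z :* (y :- x)) ≈-refl x y z)

  >⇒≉0 : ∀ {x} → 0# < x → ¬ x ≈ 0#
  >⇒≉0 (_ , 0≉x) x≈0 = 0≉x (≈-sym x≈0)

  0<1 : 0# < 1#
  0<1 = ≰⇒> λ 1≤0 → 0≉1 (≤-antisym (0≤1 1≤0) 1≤0)
    where
    0≤1 : 1# ≤ 0# → 0# ≤ 1#
    0≤1 1≤0 = ≤-by (*-nonneg (x≤y⇒0≤y-x 1≤0) (x≤y⇒0≤y-x 1≤0))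
      (solve 0 (con (+ 1) := con (+ 0) :+ (con (+ 0) :- con (+ 1)) :* (con (+ 0) :- con (+ 1))) ≈-refl)

  ⁻¹-pos : ∀ {x} → 0# < x → 0# < x ⁻¹
  ⁻¹-pos {x} 0<x = ≰⇒> λ x⁻¹≤0 → <⇒≱ 0<1 (begin
    1#          ≈⟨ *-inverseʳ x (>⇒≉0 0<x) ⟨
    x * x ⁻¹    ≤⟨ *-monoˡ-≤ x (<⇒≤ 0<x) x⁻¹≤0 ⟩
    x * 0#      ≈⟨ zeroʳ x ⟩
    0#          ∎)
    where open ≤-Reasoning

  *-⁻¹-cancel : ∀ {z} → 0# < z → ∀ x → z * x * z ⁻¹ ≈ x
  *-⁻¹-cancel {z} 0<z x = begin-equality
    z * x * z ⁻¹    ≈⟨ solve 3 (λ z x i → z :* x :* i := x :* (z :* i)) ≈-refl z x (z ⁻¹) ⟩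
    x * (z * z ⁻¹)  ≈⟨ *-congˡ (*-inverseʳ z (>⇒≉0 0<z)) ⟩
    x * 1#          ≈⟨ *-identityʳ x ⟩
    x               ∎
    where open ≤-Reasoning

  *-cancelˡ-≤ : ∀ z {x y} → 0# < z → z * x ≤ z * y → x ≤ y
  *-cancelˡ-≤ z {x} {y} 0<z zx≤zy = begin
    x               ≈⟨ *-⁻¹-cancel 0<z x ⟨
    z * x * z ⁻¹    ≤⟨ *-monoʳ-≤ (z ⁻¹) (<⇒≤ (⁻¹-pos 0<z)) zx≤zy ⟩
    z * y * z ⁻¹    ≈⟨ *-⁻¹-cancel 0<z y ⟩
    y               ∎
    where open ≤-Reasoning

  *-pos : ∀ {x y} → 0# < x → 0# < y → 0# < x * y
  *-pos {x} 0<x 0<y = ≰⇒> λ xy≤0 → <⇒≱ 0<y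
    (*-cancelˡ-≤ x 0<x (≤-trans xy≤0 (≤-reflexive (≈-sym (zeroʳ x)))))

  ·-nonneg : ∀ n {x} → 0# ≤ x → 0# ≤ n · x
  ·-nonneg zero    0≤x = ≤-refl
  ·-nonneg (suc n) 0≤x = +-nonneg 0≤x (·-nonneg n 0≤x)

  ·-monoˡ-≤ : ∀ {m n x} → 0# ≤ x → m ℕ.≤ n → m · x ≤ n · x
  ·-monoˡ-≤ {n = n} 0≤x ℕ.z≤n       = ·-nonneg n 0≤x
  ·-monoˡ-≤         0≤x (ℕ.s≤s m≤n) = +-mono-≤ ≤-refl (·-monoˡ-≤ 0≤x m≤n)

  ·≈1·* : ∀ n x → n · x ≈ n · 1# * x
  ·≈1·* zero    x = ≈-sym (zeroˡ x)
  ·≈1·* (suc n) x = begin-equality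
    x + n · x           ≈⟨ +-congˡ (·≈1·* n x) ⟩
    x + n · 1# * x      ≈⟨ solve 2 (λ x a → x :+ a :* x := (con (+ 1) :+ a) :* x) ≈-refl x (n · 1#) ⟩
    (1# + n · 1#) * x   ∎
    where open ≤-Reasoning

  ·-zero : ∀ n {x} → x ≈ 0# → n · x ≈ 0#
  ·-zero zero    x≈0 = ≈-refl
  ·-zero (suc n) x≈0 = ≈-trans (+-cong x≈0 (·-zero n x≈0)) (+-identityˡ 0#)

  -- The way back from real inequalities to natural numbers, needed to read off a comparison of
  -- `∣E∣` with `∣V∣`.
  1·-cancel-≤ : ∀ {m n} → m · 1# ≤ n · 1# → m ℕ.≤ n
  1·-cancel-≤ {zero}          _   = ℕ.z≤n
  1·-cancel-≤ {suc m} {zero}  1+m≤0 =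
    ⊥-elim (<⇒≱ (+-pos-nonneg 0<1 (·-nonneg m (<⇒≤ 0<1))) 1+m≤0)
  1·-cancel-≤ {suc m} {suc n} 1+m≤1+n = ℕ.s≤s (1·-cancel-≤ (≤-by (x≤y⇒0≤y-x 1+m≤1+n)
    (solve 2 (λ m n → n := m :+ ((con (+ 1) :+ n) :- (con (+ 1) :+ m))) ≈-refl (m · 1#) (n · 1#))))

  half : Carrier
  half = (1# + 1#) ⁻¹

  0<2 : 0# < 1# + 1#
  0<2 = +-pos-nonneg 0<1 (<⇒≤ 0<1)

  half+half≈1 : half + half ≈ 1#
  half+half≈1 = ≈-trans
    (solve 1 (λ h → h :+ h := (con (+ 1) :+ con (+ 1)) :* h) ≈-refl half)
    (*-inverseʳ _ (>⇒≉0 0<2))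

  x≤y+ε⇒x≤y : ∀ {x y} → (∀ ε → 0# < ε → x ≤ y + ε) → x ≤ y
  x≤y+ε⇒x≤y {x} {y} h with x ≤? y
  ... | yes x≤y = x≤y
  ... | no  x≰y = ⊥-elim (<⇒≱ 0<ε (≤-by (x≤y⇒0≤y-x (h ε 0<ε)) (begin-equality
    0#                       ≈⟨ -‿inverseʳ (x - y) ⟨
    x - y - (x - y)          ≈⟨ +-congʳ (*-identityʳ (x - y)) ⟨
    (x - y) * 1# - (x - y)   ≈⟨ +-congʳ (*-congˡ half+half≈1) ⟨
    (x - y) * (half + half) - (x - y)
      ≈⟨ solve 3 (λ x y h → (x :- y) :* (h :+ h) :- (x :- y)
                         := (x :- y) :* h :+ (y :+ (x :- y) :* h :- x)) ≈-refl x y half ⟩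
    ε + (y + ε - x)          ∎)))
    where
    open ≤-Reasoning
    ε = (x - y) * half
    0<ε : 0# < ε
    0<ε = *-pos (x<y⇒0<y-x (≰⇒> x≰y)) (⁻¹-pos 0<2)

  -- The supremum of the lower bounds: each member of `P` is an upper bound of these.
  infimum : (P : Pred Carrier 0ℓ) → ∃ P → ∃[ b ] (∀ x → P x → b ≤ x) → ∃ (IsGLB _≤_ P)
  infimum P (a , Pa) (b , b≤P) =
    let s , isUpper , isLeast = complete (λ c → ∀ x → P x → c ≤ x) (b , b≤P)
                                         (a , λ c c≤P → c≤P a Pa)
    in s , (λ x Px → isLeast x λ c c≤P → c≤P x Px) , isUpper

  sum-mono-≤ : ∀ {n} {f g : Fin n → Carrier} → (∀ i → f i ≤ g i) → sum f ≤ sum g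
  sum-mono-≤ {zero}  f≤g = ≤-refl
  sum-mono-≤ {suc n} f≤g = +-mono-≤ (f≤g zero) (sum-mono-≤ (f≤g ∘ suc))

  sum-zero : ∀ {n} {f : Fin n → Carrier} → (∀ i → f i ≈ 0#) → sum f ≈ 0#
  sum-zero {zero}  f≈0 = ≈-refl
  sum-zero {suc n} f≈0 = ≈-trans (+-cong (f≈0 zero) (sum-zero (f≈0 ∘ suc))) (+-identityˡ 0#)

  sum-nonneg : ∀ {n} {f : Fin n → Carrier} → (∀ i → 0# ≤ f i) → 0# ≤ sum f
  sum-nonneg {zero}  0≤f = ≤-refl
  sum-nonneg {suc n} 0≤f = +-nonneg (0≤f zero) (sum-nonneg (0≤f ∘ suc))

  sum-const : ∀ n c → sum {n} (λ _ → c) ≈ n · c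
  sum-const zero    c = ≈-refl
  sum-const (suc n) c = +-congˡ (sum-const n c)

  ·-distribˡ-sum : ∀ k {n} (f : Fin n → Carrier) → sum (λ i → k · f i) ≈ k · sum f
  ·-distribˡ-sum zero    {n} f = sum-zero {n} λ _ → ≈-refl
  ·-distribˡ-sum (suc k)     f = ≈-trans (∑-distrib-+ f _) (+-congˡ (·-distribˡ-sum k f))

  -- A point mass. It tests `i Fin.≟ a` in the same form as `μ` and `starPlan` do, so that one case
  -- split reduces both sides and a row of `starPlan` is literally an `only`.
  only : ∀ {n} → Fin n → Carrier → Fin n → Carrier
  only a c i = if does (i Fin.≟ a) then c else 0#

  sum-only : ∀ {n} (a : Fin n) c → sum (only a c) ≈ c
  sum-only {suc n} zero c = ≈-trans (+-congˡ (sum-zero {n} λ _ → ≈-refl)) (+-identityʳ c)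
  sum-only (suc a)      c = ≈-trans (+-identityˡ _) (sum-only a c)

  only-≡ : ∀ {n} (a : Fin n) c → only a c a ≈ c
  only-≡ a c with a Fin.≟ a
  ... | yes _   = ≈-refl
  ... | no  a≢a = ⊥-elim (a≢a ≡.refl)

  only-≢ : ∀ {n} {a i : Fin n} c → i ≢ a → only a c i ≈ 0#
  only-≢ {a = a} {i} c i≢a with i Fin.≟ a
  ... | yes i≡a = ⊥-elim (i≢a i≡a)
  ... | no  _   = ≈-refl

  only-nonneg : ∀ {n} (a i : Fin n) {c} → 0# ≤ c → 0# ≤ only a c i
  only-nonneg a i 0≤c with i Fin.≟ a
  ... | yes _ = 0≤c
  ... | no  _ = ≤-refl

  module _ {n} {f : Fin n → Carrier} (0≤f : ∀ i → 0# ≤ f i) where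

    private
      only₁ : ∀ a i → only a (f a) i ≤ f i
      only₁ a i with i Fin.≟ a
      ... | yes ≡.refl = ≤-refl
      ... | no  _      = 0≤f i

      only₂ : ∀ {a b} → a ≢ b → ∀ i → only a (f a) i + only b (f b) i ≤ f i
      only₂ {a} {b} a≢b i with i Fin.≟ a
      ... | no  _      = ≤-trans (≤-reflexive (+-identityˡ _)) (only₁ b i)
      ... | yes ≡.refl = ≤-reflexive (≈-trans (+-congˡ (only-≢ (f b) a≢b)) (+-identityʳ _))

      only₃ : ∀ {a b c} → a ≢ b → a ≢ c → b ≢ c →
              ∀ i → only a (f a) i + (only b (f b) i + only c (f c) i) ≤ f i
      only₃ {a} {b} {c} a≢b a≢c b≢c i with i Fin.≟ a
      ... | no  _      = ≤-trans (≤-reflexive (+-identityˡ _)) (only₂ b≢c i)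
      ... | yes ≡.refl = ≤-reflexive (≈-trans
              (+-congˡ (≈-trans (+-cong (only-≢ (f b) a≢b) (only-≢ (f c) a≢c)) (+-identityˡ 0#)))
              (+-identityʳ _))

    term≤sum : ∀ a → f a ≤ sum f
    term≤sum a = begin
      f a                  ≈⟨ sum-only a (f a) ⟨
      sum (only a (f a))   ≤⟨ sum-mono-≤ (only₁ a) ⟩
      sum f                ∎
      where open ≤-Reasoning

    two-terms≤sum : ∀ {a b} → a ≢ b → f a + f b ≤ sum f
    two-terms≤sum {a} {b} a≢b = begin
      f a + f b                                         ≈⟨ +-cong (sum-only a (f a)) (sum-only b (f b)) ⟨
      sum (only a (f a)) + sum (only b (f b))           ≈⟨ ∑-distrib-+ (only a (f a)) _ ⟨
      sum (λ i → only a (f a) i + only b (f b) i)       ≤⟨ sum-mono-≤ (only₂ a≢b) ⟩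
      sum f                                             ∎
      where open ≤-Reasoning

    -- Point masses at distinct indices never overlap, so their sum stays below `f` pointwise; no
    -- index has to be removed from the sum.
    three-terms≤sum : ∀ {a b c} → a ≢ b → a ≢ c → b ≢ c → f a + (f b + f c) ≤ sum f
    three-terms≤sum {a} {b} {c} a≢b a≢c b≢c = begin
      f a + (f b + f c)
        ≈⟨ +-cong (sum-only a (f a)) (+-cong (sum-only b (f b)) (sum-only c (f c))) ⟨
      sum (only a (f a)) + (sum (only b (f b)) + sum (only c (f c)))
        ≈⟨ +-congˡ (∑-distrib-+ (only b (f b)) _) ⟨
      sum (only a (f a)) + sum (λ i → only b (f b) i + only c (f c) i)
        ≈⟨ ∑-distrib-+ (only a (f a)) _ ⟨
      sum (λ i → only a (f a) i + (only b (f b) i + only c (f c) i))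
        ≤⟨ sum-mono-≤ (only₃ a≢b a≢c b≢c) ⟩
      sum f ∎
      where open ≤-Reasoning

-- Transition probabilities of a weight

module Transition (ℝ : Reals) (G : Graph) (𝓌 : Weight ℝ G) where
  open Reals ℝ hiding (zero)
  open OrderedField ℝ
  open Graph G
  open Weight 𝓌

  private
    d : Vertex → Carrier
    d = degree ℝ G 𝓌

  edgeTerm : Vertex → Vertex → Carrier
  edgeTerm x y = if does (x ~? y) then w x y else 0#

  edgeTerm-nonneg : ∀ x y → 0# ≤ edgeTerm x y
  edgeTerm-nonneg x y with x ~? y
  ... | yes x~y = <⇒≤ (positive x~y)
  ... | no  _   = ≤-refl

  edgeTerm-~ : ∀ {x y} → x ~ y → edgeTerm x y ≈ w x y
  edgeTerm-~ {x} {y} x~y with x ~? y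
  ... | yes _   = ≈-refl
  ... | no  x≁y = ⊥-elim (x≁y x~y)

  w≤degree : ∀ {x y} → x ~ y → w x y ≤ d x
  w≤degree {x} {y} x~y = ≤-trans (≤-reflexive (≈-sym (edgeTerm-~ x~y)))
                                 (term≤sum (edgeTerm-nonneg x) y)

  degree-pos : ∀ {x y} → x ~ y → 0# < d x
  degree-pos x~y = <-≤-trans (positive x~y) (w≤degree x~y)

  degree-nonneg : ∀ x → 0# ≤ d x
  degree-nonneg x = sum-nonneg (edgeTerm-nonneg x)

  -- Extended by `0#` off the edges, so that sums run over all vertices without side conditions.
  p : Vertex → Vertex → Carrier
  p x y = if does (x ~? y) then w x y * d x ⁻¹ else 0#

  p-≁ : ∀ {x y} → ¬ x ~ y → p x y ≈ 0#
  p-≁ {x} {y} x≁y with x ~? y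
  ... | yes x~y = ⊥-elim (x≁y x~y)
  ... | no  _   = ≈-refl

  p-pos : ∀ {x y} → x ~ y → 0# < p x y
  p-pos {x} {y} x~y with x ~? y
  ... | yes _   = *-pos (positive x~y) (⁻¹-pos (degree-pos x~y))
  ... | no  x≁y = ⊥-elim (x≁y x~y)

  p-nonneg : ∀ x y → 0# ≤ p x y
  p-nonneg x y with x ~? y
  ... | yes x~y = *-nonneg (<⇒≤ (positive x~y)) (<⇒≤ (⁻¹-pos (degree-pos x~y)))
  ... | no  _   = ≤-refl

  degree*p : ∀ {x y} → x ~ y → d x * p x y ≈ w x y
  degree*p {x} {y} x~y with x ~? y
  ... | no  x≁y = ⊥-elim (x≁y x~y)
  ... | yes _   = begin-equality
    d x * (w x y * d x ⁻¹)  ≈⟨ solve 3 (λ d w i → d :* (w :* i) := w :* (d :* i))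
                                 ≈-refl (d x) (w x y) (d x ⁻¹) ⟩
    w x y * (d x * d x ⁻¹)  ≈⟨ *-congˡ (*-inverseʳ _ (>⇒≉0 (degree-pos x~y))) ⟩
    w x y * 1#              ≈⟨ *-identityʳ _ ⟩
    w x y                   ∎
    where open ≤-Reasoning

  sum-p : ∀ {x y} → x ~ y → sum (p x) ≈ 1#
  sum-p {x} x~y = begin-equality
    sum (p x)                             ≈⟨ sum-cong-≋ p≈ ⟩
    sum (λ z → d x ⁻¹ * edgeTerm x z)     ≈⟨ *-distribˡ-sum (d x ⁻¹) (edgeTerm x) ⟨
    d x ⁻¹ * d x                          ≈⟨ *-comm _ _ ⟩
    d x * d x ⁻¹                          ≈⟨ *-inverseʳ _ (>⇒≉0 (degree-pos x~y)) ⟩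
    1#                                    ∎
    where
    open ≤-Reasoning
    p≈ : ∀ z → p x z ≈ d x ⁻¹ * edgeTerm x z
    p≈ z with x ~? z
    ... | yes _ = *-comm _ _
    ... | no  _ = ≈-sym (zeroʳ _)

  -- The nested cases of `μ` become a sum because `p x x` vanishes by irreflexivity; in this form
  -- the measure can be summed term by term.
  μ≈ : ∀ α x z → μ ℝ G 𝓌 α x z ≈ only x α z + (1# - α) * p x z
  μ≈ α x z with z Fin.≟ x
  ... | yes ≡.refl = ≈-sym (≈-trans (+-congˡ (≈-trans (*-congˡ (p-≁ (~-irrefl ≡.refl))) (zeroʳ _)))
                                    (+-identityʳ α))
  ... | no  _ with x ~? z
  ...   | yes _ = ≈-sym (+-identityˡ _)
  ...   | no  _ = ≈-sym (≈-trans (+-identityˡ _) (zeroʳ _))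

  μ-≁ : ∀ α {x z} → z ≢ x → ¬ x ~ z → μ ℝ G 𝓌 α x z ≈ 0#
  μ-≁ α {x} {z} z≢x x≁z with z Fin.≟ x
  ... | yes z≡x = ⊥-elim (z≢x z≡x)
  ... | no  _ with x ~? z
  ...   | yes x~z = ⊥-elim (x≁z x~z)
  ...   | no  _   = ≈-refl

  μ-nonneg : ∀ {α} → 0# ≤ α → α < 1# → ∀ x z → 0# ≤ μ ℝ G 𝓌 α x z
  μ-nonneg {α} 0≤α α<1 x z = ≤-trans
    (+-nonneg (only-nonneg x z 0≤α) (*-nonneg (<⇒≤ (x<y⇒0<y-x α<1)) (p-nonneg x z)))
    (≤-reflexive (≈-sym (μ≈ α x z)))

-- Optimal transport along an edge

-- A Kantorovich potential for the edge x ~ y: it grows at unit speed from the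
-- neighbours of x through x and y to the neighbours of y.
record Potential (G : Graph) (x y : Graph.Vertex G) : Set where
  open Graph G
  field
    height      : Vertex → ℕ
    lipschitz   : ∀ {a b} → a ~ b → height b ℕ.≤ suc (height a)
    height-tail : height x ≡ 1
    height-head : height y ≡ 2
    height-in   : ∀ {u} → x ~ u → u ≢ y → height u ≡ 0
    height-out  : ∀ {v} → y ~ v → v ≢ x → height v ≡ 3

  height-walk : ∀ k {a b} → Walk k a b → height b ℕ.≤ k ℕ.+ height a
  height-walk zero    ≡.refl = ℕ.≤-refl
  height-walk (suc k) {a} {b} (c , a~c , walk) = begin
    height b                ≤⟨ height-walk k walk ⟩
    k ℕ.+ height c          ≤⟨ ℕ.+-monoʳ-≤ k (lipschitz a~c) ⟩
    k ℕ.+ suc (height a)    ≡⟨ ℕ.+-suc k (height a) ⟩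
    suc k ℕ.+ height a      ∎
    where open ℕ.≤-Reasoning

module _ (G : Graph) (conn : Connected G) where
  open Graph G

  dist-walk : ∀ x y → Walk (dist G conn x y) x y
  dist-walk x y = let k , walk = Connected.walk conn x y in
    proj₁ (proj₂ (least (λ k → walk? k x y) k walk))

  dist-min : ∀ {x y} k → Walk k x y → dist G conn x y ℕ.≤ k
  dist-min {x} {y} = let k , walk = Connected.walk conn x y in
    proj₂ (proj₂ (least (λ k → walk? k x y) k walk))

module Transport (ℝ : Reals) (G : Graph) (conn : Connected G) where
  open Reals ℝ hiding (zero)
  open OrderedField ℝ
  open Graph G

  private
    dₒ : Vertex → Vertex → ℕ
    dₒ = dist G conn

  module _ {μ₁ μ₂ π} (π-coupling : IsCoupling ℝ G μ₁ μ₂ π) (h : Vertex → ℕ) where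
    open IsCoupling π-coupling

    sum-source : sum (λ s → sum λ t → h s · π s t) ≈ sum (λ s → h s · μ₁ s)
    sum-source = sum-cong-≋ λ s →
      ≈-trans (·-distribˡ-sum (h s) (π s)) (×-congʳ (h s) (marginal₁ s))

    sum-target : sum (λ s → sum λ t → h t · π s t) ≈ sum (λ t → h t · μ₂ t)
    sum-target = ≈-trans (∑-comm (λ s t → h t · π s t)) (sum-cong-≋ λ t →
      ≈-trans (·-distribˡ-sum (h t) (λ s → π s t)) (×-congʳ (h t) (marginal₂ t)))

    -- Adding the source heights to the cost, rather than subtracting them from the target heights,
    -- keeps every coefficient of `π s t` a natural number.
    cost+source : cost ℝ G conn π + sum (λ s → h s · μ₁ s)
                  ≈ sum (λ s → sum λ t → (dₒ s t ℕ.+ h s) · π s t)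
    cost+source = begin-equality
      cost ℝ G conn π + sum (λ s → h s · μ₁ s)
        ≈⟨ +-congˡ sum-source ⟨
      cost ℝ G conn π + sum (λ s → sum λ t → h s · π s t)
        ≈⟨ ∑-distrib-+ (λ s → sum λ t → dₒ s t · π s t) _ ⟨
      sum (λ s → sum (λ t → dₒ s t · π s t) + sum λ t → h s · π s t)
        ≈⟨ (sum-cong-≋ λ s → ≈-trans (≈-sym (∑-distrib-+ (λ t → dₒ s t · π s t) _))
             (sum-cong-≋ λ t → ≈-sym (×-homo-+ (π s t) (dₒ s t) (h s)))) ⟩
      sum (λ s → sum λ t → (dₒ s t ℕ.+ h s) · π s t) ∎
      where open ≤-Reasoning

    -- Weak Kantorovich duality: each unit of mass travels at least as far as it climbs.
    duality : (∀ s t → h t ℕ.≤ dₒ s t ℕ.+ h s) →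
              sum (λ t → h t · μ₂ t) ≤ cost ℝ G conn π + sum (λ s → h s · μ₁ s)
    duality h-lip = begin
      sum (λ t → h t · μ₂ t)
        ≈⟨ sum-target ⟨
      sum (λ s → sum λ t → h t · π s t)
        ≤⟨ (sum-mono-≤ λ s → sum-mono-≤ λ t → ·-monoˡ-≤ (nonneg s t) (h-lip s t)) ⟩
      sum (λ s → sum λ t → (dₒ s t ℕ.+ h s) · π s t)
        ≈⟨ cost+source ⟨
      cost ℝ G conn π + sum (λ s → h s · μ₁ s) ∎
      where open ≤-Reasoning

    -- The reverse of `duality` for a plan that uses only pairs where the climb accounts for the
    -- whole distance; together they certify plan and potential as optimal.
    complementary-slackness : (∀ s t → (π s t ≈ 0#) ⊎ (dₒ s t ℕ.+ h s ℕ.≤ h t)) →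
              cost ℝ G conn π + sum (λ s → h s · μ₁ s) ≤ sum (λ t → h t · μ₂ t)
    complementary-slackness slack = begin
      cost ℝ G conn π + sum (λ s → h s · μ₁ s)
        ≈⟨ cost+source ⟩
      sum (λ s → sum λ t → (dₒ s t ℕ.+ h s) · π s t)
        ≤⟨ (sum-mono-≤ λ s → sum-mono-≤ λ t → tight s t (slack s t)) ⟩
      sum (λ s → sum λ t → h t · π s t)
        ≈⟨ sum-target ⟩
      sum (λ t → h t · μ₂ t) ∎
      where
      open ≤-Reasoning
      tight : ∀ s t → (π s t ≈ 0#) ⊎ (dₒ s t ℕ.+ h s ℕ.≤ h t) →
              (dₒ s t ℕ.+ h s) · π s t ≤ h t · π s t
      tight s t (inj₁ π≈0) = ≤-reflexive
        (≈-trans (·-zero (dₒ s t ℕ.+ h s) π≈0) (≈-sym (·-zero (h t) π≈0)))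
      tight s t (inj₂ ≤h)  = ·-monoˡ-≤ (nonneg s t) ≤h

  -- Mass outside x moves to y, mass outside y comes from x, and x sends c to y.
  starPlan : Vertex → Vertex → Carrier → (m₁ m₂ : Vertex → Carrier) →
             Vertex → Vertex → Carrier
  starPlan x y c m₁ m₂ s t =
    if does (s Fin.≟ x) then (if does (t Fin.≟ y) then c else m₂ t)
    else (if does (t Fin.≟ y) then m₁ s else 0#)

  -- One elimination principle for both nonnegativity and slackness of the plan.
  starPlan-cases : ∀ x y c m₁ m₂ (P : Vertex → Vertex → Carrier → Set) →
    P x y c → (∀ t → t ≢ y → P x t (m₂ t)) → (∀ s → s ≢ x → P s y (m₁ s)) →
    (∀ s t → P s t 0#) → ∀ s t → P s t (starPlan x y c m₁ m₂ s t)
  starPlan-cases x y c m₁ m₂ P Pxy Px Py P₀ s t with s Fin.≟ x | t Fin.≟ y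
  ... | yes ≡.refl | yes ≡.refl = Pxy
  ... | yes ≡.refl | no  t≢y    = Px t t≢y
  ... | no  s≢x    | yes ≡.refl = Py s s≢x
  ... | no  _      | no  _      = P₀ s t

  starPlan-coupling : ∀ x y {c m₁ m₂} → 0# ≤ c → (∀ s → 0# ≤ m₁ s) → (∀ t → 0# ≤ m₂ t) →
    c + (sum m₂ - m₂ y) ≈ m₁ x → c + (sum m₁ - m₁ x) ≈ m₂ y →
    IsCoupling ℝ G m₁ m₂ (starPlan x y c m₁ m₂)
  starPlan-coupling x y {c} {m₁} {m₂} 0≤c 0≤m₁ 0≤m₂ row column = record
    { nonneg    = starPlan-cases x y c m₁ m₂ (λ _ _ → 0# ≤_) 0≤c (λ t _ → 0≤m₂ t)
                    (λ s _ → 0≤m₁ s) (λ _ _ → ≤-refl)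
    ; marginal₁ = marginal₁
    ; marginal₂ = marginal₂
    }
    where
    open ≤-Reasoning
    sum-replace : ∀ z (m : Vertex → Carrier) →
      sum (λ t → if does (t Fin.≟ z) then c else m t) ≈ c + (sum m - m z)
    sum-replace z m = begin-equality
      sum (λ t → if does (t Fin.≟ z) then c else m t)
        ≈⟨ sum-cong-≋ pointwise ⟩
      sum (λ t → only z (c - m z) t + m t)
        ≈⟨ ∑-distrib-+ (only z (c - m z)) m ⟩
      sum (only z (c - m z)) + sum m
        ≈⟨ +-congʳ (sum-only z _) ⟩
      c - m z + sum m
        ≈⟨ solve 3 (λ c m s → c :- m :+ s := c :+ (s :- m)) ≈-refl c (m z) (sum m) ⟩
      c + (sum m - m z) ∎
      where
      pointwise : ∀ t → (if does (t Fin.≟ z) then c else m t) ≈ only z (c - m z) t + m t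
      pointwise t with t Fin.≟ z
      ... | yes ≡.refl = solve 2 (λ c m → c := c :- m :+ m) ≈-refl c (m t)
      ... | no  _      = ≈-sym (+-identityˡ _)
    marginal₁ : ∀ s → sum (starPlan x y c m₁ m₂ s) ≈ m₁ s
    marginal₁ s with s Fin.≟ x
    ... | yes ≡.refl = ≈-trans (sum-replace y m₂) row
    ... | no  _      = sum-only y (m₁ s)
    marginal₂ : ∀ t → sum (λ s → starPlan x y c m₁ m₂ s t) ≈ m₂ t
    marginal₂ t with t Fin.≟ y
    ... | yes ≡.refl = ≈-trans (sum-replace x m₁) column
    ... | no  _      = sum-only x (m₂ t)

  module _ (𝓌 : Weight ℝ G) where
    open Transition ℝ G 𝓌

    module _ {x y} (x~y : x ~ y) (potential : Potential G x y) where
      open Potential potential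

      excess : Carrier
      excess = (1# + 1#) * (p x y + p y x - 1#)

      module _ (α : Carrier) where
        private
          β : Carrier
          β = 1# - α
          x≢y : x ≢ y
          x≢y x≡y = ~-irrefl x≡y x~y
          μˣ μʸ : Vertex → Carrier
          μˣ = μ ℝ G 𝓌 α x
          μʸ = μ ℝ G 𝓌 α y

        optimum : Carrier
        optimum = 1# - β * excess

        -- The neighbours of `x` other than `y` lie at height 0, so only the mass `α` at height 1
        -- and the mass at `y` at height 2 count.
        source-height : sum (λ s → height s · μˣ s) ≈ α + β * ((1# + 1#) * p x y)
        source-height = begin-equality
          sum (λ s → height s · μˣ s)
            ≈⟨ sum-cong-≋ pointwise ⟩
          sum (λ s → only x α s + only y (β * ((1# + 1#) * p x y)) s)
            ≈⟨ ∑-distrib-+ (only x α) _ ⟩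
          sum (only x α) + sum (only y (β * ((1# + 1#) * p x y)))
            ≈⟨ +-cong (sum-only x α) (sum-only y _) ⟩
          α + β * ((1# + 1#) * p x y) ∎
          where
          open ≤-Reasoning
          pointwise : ∀ s → height s · μˣ s ≈ only x α s + only y (β * ((1# + 1#) * p x y)) s
          pointwise s with s Fin.≟ y
          ... | yes ≡.refl rewrite height-head = begin-equality
            2 · μˣ y
              ≈⟨ ×-congʳ 2 (μ≈ α x y) ⟩
            2 · (only x α y + β * p x y)
              ≈⟨ solve 3 (λ a b p → (a :+ b :* p) :+ ((a :+ b :* p) :+ con (+ 0))
                           := (a :+ a) :+ b :* ((con (+ 1) :+ con (+ 1)) :* p)) ≈-refl _ _ _ ⟩
            (only x α y + only x α y) + β * ((1# + 1#) * p x y)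
              ≈⟨ +-congʳ (+-cong (only-≢ α (x≢y ∘ ≡.sym)) ≈-refl) ⟩
            (0# + only x α y) + β * ((1# + 1#) * p x y)
              ≈⟨ +-congʳ (+-identityˡ _) ⟩
            only x α y + β * ((1# + 1#) * p x y) ∎
          ... | no  s≢y with s Fin.≟ x
          ...   | yes ≡.refl rewrite height-tail = ≈-refl
          ...   | no  s≢x with x ~? s
          ...     | yes x~s rewrite height-in x~s s≢y = ≈-sym (+-identityˡ 0#)
          ...     | no  x≁s = ≈-trans (·-zero (height s) ≈-refl) (≈-sym (+-identityˡ 0#))

        -- All neighbours of `y` are first charged height 3, which lets `sum-p` apply; the
        -- correction at `x`, whose height is 1, is the subtracted `2 * p y x`.
        target-height : sum (λ t → height t · μʸ t)
                        ≈ (1# + 1#) * α + β * ((1# + 1# + 1#) - (1# + 1#) * p y x)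
        target-height = begin-equality
          sum (λ t → height t · μʸ t)
            ≈⟨ sum-cong-≋ pointwise ⟩
          sum (λ t → only y ((1# + 1#) * α) t
                     + (β * (1# + 1# + 1#) * p y t + only x (- (β * ((1# + 1#) * p y x))) t))
            ≈⟨ ∑-distrib-+ (only y ((1# + 1#) * α)) _ ⟩
          sum (only y ((1# + 1#) * α))
            + sum (λ t → β * (1# + 1# + 1#) * p y t + only x (- (β * ((1# + 1#) * p y x))) t)
            ≈⟨ +-cong (sum-only y _) (∑-distrib-+ (λ t → β * (1# + 1# + 1#) * p y t) _) ⟩
          (1# + 1#) * α
            + (sum (λ t → β * (1# + 1# + 1#) * p y t) + sum (only x (- (β * ((1# + 1#) * p y x)))))
            ≈⟨ +-congˡ (+-cong (≈-sym (*-distribˡ-sum _ (p y))) (sum-only x _)) ⟩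
          (1# + 1#) * α + (β * (1# + 1# + 1#) * sum (p y) - β * ((1# + 1#) * p y x))
            ≈⟨ +-congˡ (+-congʳ (*-congˡ (sum-p (~-sym x~y)))) ⟩
          (1# + 1#) * α + (β * (1# + 1# + 1#) * 1# - β * ((1# + 1#) * p y x))
            ≈⟨ solve 3 (λ a b q → two :* a :+ (b :* three :* con (+ 1) :- b :* (two :* q))
                         := two :* a :+ b :* (three :- two :* q)) ≈-refl α β (p y x) ⟩
          (1# + 1#) * α + β * ((1# + 1# + 1#) - (1# + 1#) * p y x) ∎
          where
          open ≤-Reasoning
          two = λ {n} → con {n} (+ 1) :+ con (+ 1)
          three = λ {n} → con {n} (+ 1) :+ con (+ 1) :+ con (+ 1)
          pointwise : ∀ t → height t · μʸ t ≈ only y ((1# + 1#) * α) t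
                      + (β * (1# + 1# + 1#) * p y t + only x (- (β * ((1# + 1#) * p y x))) t)
          pointwise t with t Fin.≟ x
          ... | yes ≡.refl rewrite height-tail = begin-equality
            1 · μʸ x
              ≈⟨ ×-congʳ 1 (μ≈ α y x) ⟩
            1 · (only y α x + β * p y x)
              ≈⟨ +-congʳ (+-congʳ (only-≢ α x≢y)) ⟩
            (0# + β * p y x) + 0#
              ≈⟨ solve 2 (λ b q → (con (+ 0) :+ b :* q) :+ con (+ 0)
                    := con (+ 0) :+ (b :* three :* q :- b :* (two :* q))) ≈-refl β (p y x) ⟩
            0# + (β * (1# + 1# + 1#) * p y x - β * ((1# + 1#) * p y x))
              ≈⟨ +-congʳ (only-≢ _ x≢y) ⟨
            only y ((1# + 1#) * α) x + (β * (1# + 1# + 1#) * p y x - β * ((1# + 1#) * p y x)) ∎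
          ... | no  t≢x with t Fin.≟ y
          ...   | yes ≡.refl rewrite height-head = begin-equality
            2 · α
              ≈⟨ solve 2 (λ a b → a :+ (a :+ con (+ 0))
                    := two :* a :+ (b :* three :* con (+ 0) :+ con (+ 0))) ≈-refl α β ⟩
            (1# + 1#) * α + (β * (1# + 1# + 1#) * 0# + 0#)
              ≈⟨ +-congˡ (+-congʳ (*-congˡ (p-≁ (~-irrefl ≡.refl)))) ⟨
            (1# + 1#) * α + (β * (1# + 1# + 1#) * p y y + 0#) ∎
          ...   | no  t≢y with y ~? t
          ...     | yes y~t rewrite height-out y~t t≢x =
            solve 2 (λ b q → b :* q :+ (b :* q :+ (b :* q :+ con (+ 0)))
                    := con (+ 0) :+ (b :* three :* q :+ con (+ 0))) ≈-refl β _
          ...     | no  y≁t = ≈-trans (·-zero (height t) ≈-refl)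
            (solve 1 (λ b → con (+ 0) := con (+ 0) :+ (b :* three :* con (+ 0) :+ con (+ 0))) ≈-refl β)

        optimum-balance : sum (λ t → height t · μʸ t) ≈ optimum + sum (λ s → height s · μˣ s)
        optimum-balance = begin-equality
          sum (λ t → height t · μʸ t)
            ≈⟨ target-height ⟩
          (1# + 1#) * α + β * ((1# + 1# + 1#) - (1# + 1#) * p y x)
            ≈⟨ solve 3 (λ a p q → let one = con (+ 1); two = one :+ one in
                  two :* a :+ (one :- a) :* ((one :+ one :+ one) :- two :* q)
               := one :- (one :- a) :* (two :* (p :+ q :- one))
                    :+ (a :+ (one :- a) :* (two :* p))) ≈-refl α (p x y) (p y x) ⟩
          optimum + (α + β * ((1# + 1#) * p x y))
            ≈⟨ +-congˡ source-height ⟨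
          optimum + sum (λ s → height s · μˣ s) ∎
          where open ≤-Reasoning

        -- Rests on the potential alone and thus holds for every `α`, which is what bounds an
        -- arbitrary limit in `κLLY≤excess`.
        optimum-lower : ∀ {π} → IsCoupling ℝ G μˣ μʸ π → optimum ≤ cost ℝ G conn π
        optimum-lower π-coupling = +-cancelʳ-≤ _ (≤-trans
          (≤-reflexive (≈-sym optimum-balance))
          (duality π-coupling height λ s t → height-walk _ (dist-walk G conn s t)))

        module _ (0≤α : 0# ≤ α) (α<1 : α < 1#) (β≤α : β ≤ α) where

          private
            sum-μ : ∀ {z u} → z ~ u → sum (μ ℝ G 𝓌 α z) ≈ 1#
            sum-μ {z} z~u = begin-equality
              sum (μ ℝ G 𝓌 α z)
                ≈⟨ sum-cong-≋ (μ≈ α z) ⟩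
              sum (λ t → only z α t + β * p z t)
                ≈⟨ ∑-distrib-+ (only z α) _ ⟩
              sum (only z α) + sum (λ t → β * p z t)
                ≈⟨ +-cong (sum-only z α) (≈-sym (*-distribˡ-sum β (p z))) ⟩
              α + β * sum (p z)
                ≈⟨ +-congˡ (*-congˡ (sum-p z~u)) ⟩
              α + β * 1#
                ≈⟨ solve 1 (λ a → a :+ (con (+ 1) :- a) :* con (+ 1) := con (+ 1)) ≈-refl α ⟩
              1# ∎
              where open ≤-Reasoning

            μ-diagonal : ∀ z → μ ℝ G 𝓌 α z z ≈ α
            μ-diagonal z = ≈-trans (μ≈ α z z) (≈-trans
              (+-cong (only-≡ z α) (≈-trans (*-congˡ (p-≁ (~-irrefl ≡.refl))) (zeroʳ β)))
              (+-identityʳ α))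

            remainder : ∀ z z′ {u} → z ~ u →
                        α - β + (sum (μ ℝ G 𝓌 α z) - μ ℝ G 𝓌 α z z) ≈ μ ℝ G 𝓌 α z′ z′
            remainder z z′ z~u = begin-equality
              α - β + (sum (μ ℝ G 𝓌 α z) - μ ℝ G 𝓌 α z z)
                ≈⟨ +-congˡ (+-cong (sum-μ z~u) (-‿cong (μ-diagonal z))) ⟩
              α - β + (1# - α)
                ≈⟨ solve 1 (λ a → a :- (con (+ 1) :- a) :+ (con (+ 1) :- a) := a) ≈-refl α ⟩
              α
                ≈⟨ μ-diagonal z′ ⟨
              μ ℝ G 𝓌 α z′ z′ ∎
              where open ≤-Reasoning

            -- Outside `y` the target carries mass `β`, all of it supplied by `x`; the rest of the
            -- `α` sitting at `x`, namely `α - β`, goes to `y`. This is where `β ≤ α` is used.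
            plan : Vertex → Vertex → Carrier
            plan = starPlan x y (α - β) μˣ μʸ

          plan-coupling : IsCoupling ℝ G μˣ μʸ plan
          plan-coupling = starPlan-coupling x y (x≤y⇒0≤y-x β≤α)
            (μ-nonneg 0≤α α<1 x) (μ-nonneg 0≤α α<1 y)
            (remainder y x (~-sym x~y)) (remainder x y x~y)

          -- Distances are bounded above by explicit walks of length at most 2 through the edge;
          -- they need not be computed, as the potential supplies the opposite bound.
          plan-slack : ∀ s t → (plan s t ≈ 0#) ⊎ (dₒ s t ℕ.+ height s ℕ.≤ height t)
          plan-slack = starPlan-cases x y (α - β) μˣ μʸ
            (λ s t → λ π → (π ≈ 0#) ⊎ (dₒ s t ℕ.+ height s ℕ.≤ height t))
            (inj₂ x→y) from-x to-y (λ _ _ → inj₁ ≈-refl)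
            where
            x→y : dₒ x y ℕ.+ height x ℕ.≤ height y
            x→y rewrite height-tail | height-head =
              ℕ.+-monoˡ-≤ 1 (dist-min G conn 1 (y , x~y , ≡.refl))
            from-x : ∀ t → t ≢ y → (μʸ t ≈ 0#) ⊎ (dₒ x t ℕ.+ height x ℕ.≤ height t)
            from-x t t≢y with t Fin.≟ x
            ... | yes ≡.refl = inj₂ (ℕ.+-monoˡ-≤ (height x) (dist-min G conn 0 ≡.refl))
            ... | no  t≢x = from-x-outside (y ~? t)
              where
              from-x-outside : Dec (y ~ t) → (μʸ t ≈ 0#) ⊎ (dₒ x t ℕ.+ height x ℕ.≤ height t)
              from-x-outside (no  y≁t) = inj₁ (μ-≁ α t≢y y≁t)
              from-x-outside (yes y~t) rewrite height-tail | height-out y~t t≢x =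
                inj₂ (ℕ.+-monoˡ-≤ 1 (dist-min G conn 2 (y , x~y , t , y~t , ≡.refl)))
            to-y : ∀ s → s ≢ x → (μˣ s ≈ 0#) ⊎ (dₒ s y ℕ.+ height s ℕ.≤ height y)
            to-y s s≢x with s Fin.≟ y
            ... | yes ≡.refl = inj₂ (ℕ.+-monoˡ-≤ (height y) (dist-min G conn 0 ≡.refl))
            ... | no  s≢y = to-y-outside (x ~? s)
              where
              to-y-outside : Dec (x ~ s) → (μˣ s ≈ 0#) ⊎ (dₒ s y ℕ.+ height s ℕ.≤ height y)
              to-y-outside (no  x≁s) = inj₁ (μ-≁ α s≢x x≁s)
              to-y-outside (yes x~s) rewrite height-head | height-in x~s s≢y =
                inj₂ (ℕ.+-monoˡ-≤ 0 (dist-min G conn 2 (x , ~-sym x~s , y , x~y , ≡.refl)))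

          W₁≈optimum : IsW₁ ℝ G conn μˣ μʸ optimum
          W₁≈optimum =
              (λ { r (π , π-coupling , r≈cost) →
                   ≤-trans (optimum-lower π-coupling) (≤-reflexive (≈-sym r≈cost)) })
            , (λ b b≤ → ≤-trans (b≤ _ (plan , plan-coupling , ≈-refl)) (+-cancelʳ-≤ _ (≤-trans
                (complementary-slackness plan-coupling height plan-slack)
                (≤-reflexive optimum-balance))))

      IsκLLY-excess : IsκLLY ℝ G conn 𝓌 x y excess
      -- For `α > 1/2` the quotient is constantly `excess`, so the same `δ` serves every `ε`.
      IsκLLY-excess ε 0<ε = half , ⁻¹-pos 0<2 , λ α 0≤α α<1 1-½<α →
        let β = 1# - α
            0<β = x<y⇒0<y-x α<1
            β≤α : β ≤ α
            β≤α = ≤-by (+-nonneg (x≤y⇒0≤y-x (<⇒≤ 1-½<α)) (x≤y⇒0≤y-x (<⇒≤ 1-½<α))) (begin-equality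
              α   ≈⟨ solve 1 (λ a → let one = con (+ 1) in
                       a := (one :- a) :+ ((a :- one) :+ (a :- one) :+ one)) ≈-refl α ⟩
              β + ((α - 1#) + (α - 1#) + 1#)              ≈⟨ +-congˡ (+-congˡ half+half≈1) ⟨
              β + ((α - 1#) + (α - 1#) + (half + half))
                  ≈⟨ solve 3 (λ b a h → let one = con (+ 1) in
                       b :+ ((a :- one) :+ (a :- one) :+ (h :+ h))
                       := b :+ ((a :- (one :- h)) :+ (a :- (one :- h)))) ≈-refl β α half ⟩
              β + ((α - (1# - half)) + (α - (1# - half)))  ∎)
            quotient : β * excess * β ⁻¹ ≈ excess
            quotient = *-⁻¹-cancel 0<β excess
            small : ∀ {u v} → u ≈ v → u - v < ε
            small u≈v = <-by 0<ε (≈-sym (≈-trans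
              (+-congʳ (≈-trans (+-congʳ u≈v) (-‿inverseʳ _))) (+-identityˡ ε)))
        in β * excess
         , ( optimum α , W₁≈optimum α 0≤α α<1 β≤α
           , solve 1 (λ e → e := con (+ 1) :- (con (+ 1) :- e)) ≈-refl (β * excess) )
         , small quotient , small (≈-sym quotient)
        where open ≤-Reasoning

      -- A single `α` near 1 suffices for each `ε`: the potential gives `k ≤ β * excess` for
      -- whatever curvature value `k` the limit supplies there.
      κLLY≤excess : ∀ {l} → IsκLLY ℝ G conn 𝓌 x y l → l ≤ excess
      κLLY≤excess {l} l-limit = x≤y+ε⇒x≤y λ ε 0<ε →
        let δ , 0<δ , near = l-limit ε 0<ε
            α , 0≤α , α<1 , 1-δ<α = close 0<δ
            β = 1# - α
            0<β = x<y⇒0<y-x α<1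
            k , (r , (_ , r-greatest) , k≈1-r) , _ , l-k/β<ε = near α 0≤α α<1 1-δ<α
            optimum≤r : optimum α ≤ r
            optimum≤r = r-greatest (optimum α) λ { _ (π , π-coupling , r′≈cost) →
              ≤-trans (optimum-lower α π-coupling) (≤-reflexive (≈-sym r′≈cost)) }
            k≤ : k ≤ β * excess
            k≤ = begin
              k                         ≈⟨ k≈1-r ⟩
              1# - r                    ≤⟨ ≤-by (x≤y⇒0≤y-x optimum≤r) (solve 2 (λ r o →
                                             let one = con (+ 1) in
                                             one :- o := (one :- r) :+ (r :- o))
                                             ≈-refl r (optimum α)) ⟩
              1# - optimum α            ≈⟨ solve 1 (λ e → con (+ 1) :- (con (+ 1) :- e) := e)
                                             ≈-refl (β * excess) ⟩
              β * excess                ∎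
            k/β≤ : k * β ⁻¹ ≤ excess
            k/β≤ = begin
              k * β ⁻¹                  ≤⟨ *-monoʳ-≤ (β ⁻¹) (<⇒≤ (⁻¹-pos 0<β)) k≤ ⟩
              β * excess * β ⁻¹         ≈⟨ *-⁻¹-cancel 0<β excess ⟩
              excess                    ∎
        in begin
          l                             ≈⟨ solve 2 (λ l k → l := k :+ (l :- k)) ≈-refl l (k * β ⁻¹) ⟩
          k * β ⁻¹ + (l - k * β ⁻¹)     ≤⟨ +-mono-≤ k/β≤ (<⇒≤ l-k/β<ε) ⟩
          excess + ε                    ∎
        where
        open ≤-Reasoning
        close : ∀ {δ} → 0# < δ → ∃[ α ] (0# ≤ α × α < 1# × 1# - δ < α)
        -- The midpoint `1 - δ/2` of the allowed range is nonnegative when `δ ≤ 1`; for larger `δ`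
        -- the range already contains 0.
        close {δ} 0<δ with δ ≤? 1#
        ... | yes δ≤1 = 1# - δ * half , 0≤α , α<1 , 1-δ<α
          where
          0<δ/2 : 0# < δ * half
          0<δ/2 = *-pos 0<δ (⁻¹-pos 0<2)
          δ≈ : δ ≈ δ * half + δ * half
          δ≈ = ≈-trans (≈-sym (*-identityʳ δ))
                 (≈-trans (*-congˡ (≈-sym half+half≈1)) (distribˡ δ half half))
          0≤α : 0# ≤ 1# - δ * half
          0≤α = x≤y⇒0≤y-x (≤-trans (≤-by (<⇒≤ 0<δ/2) δ≈) δ≤1)
          α<1 : 1# - δ * half < 1#
          α<1 = <-by 0<δ/2 (solve 1 (λ h → con (+ 1) := con (+ 1) :- h :+ h) ≈-refl (δ * half))
          1-δ<α : 1# - δ < 1# - δ * half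
          1-δ<α = <-by 0<δ/2 (≈-trans
            (solve 1 (λ h → con (+ 1) :- h := con (+ 1) :- (h :+ h) :+ h) ≈-refl (δ * half))
            (+-congʳ (+-congˡ (-‿cong (≈-sym δ≈)))))
        ... | no  δ≰1 = 0# , ≤-refl , 0<1 , <-by (x<y⇒0<y-x (≰⇒> δ≰1))
          (solve 1 (λ d → con (+ 0) := con (+ 1) :- d :+ (d :- con (+ 1))) ≈-refl δ)

-- Trails, cycles and the potential in girth at least 6

module Cycles (G : Graph) where
  open Graph G

  -- A non-backtracking walk, indexed by its length, its first two and its last
  -- two vertices.
  data Trail : ℕ → (a b c d : Vertex) → Set where
    edge : ∀ {a b} → a ~ b → Trail 1 a b a b
    cons : ∀ {k a b c d e} → a ~ b → a ≢ c → Trail k b c d e → Trail (suc k) a b d e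

  snoc : ∀ {k a b c d e} → Trail k a b c d → d ~ e → c ≢ e → Trail (suc k) a b d e
  snoc (edge a~b)         b~e a≢e = cons a~b a≢e (edge b~e)
  snoc (cons a~b a≢c t)   d~e c≢e = cons a~b a≢c (snoc t d~e c≢e)

  -- Positions past the end repeat the last vertex, which makes the function total on `ℕ`.
  vertexAt : ∀ {k a b c d} → Trail k a b c d → ℕ → Vertex
  vertexAt (edge {a}     _)     zero    = a
  vertexAt (edge {_} {b} _)     (suc _) = b
  vertexAt (cons {a = a} _ _ t) zero    = a
  vertexAt (cons         _ _ t) (suc i) = vertexAt t i

  vertexAt-0 : ∀ {k a b c d} (t : Trail k a b c d) → vertexAt t 0 ≡ a
  vertexAt-0 (edge _)     = ≡.refl
  vertexAt-0 (cons _ _ _) = ≡.refl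

  vertexAt-1 : ∀ {k a b c d} (t : Trail k a b c d) → vertexAt t 1 ≡ b
  vertexAt-1 (edge _)     = ≡.refl
  vertexAt-1 (cons _ _ t) = vertexAt-0 t

  vertexAt-end : ∀ {k a b c d} (t : Trail k a b c d) → vertexAt t k ≡ d
  vertexAt-end (edge _)     = ≡.refl
  vertexAt-end (cons _ _ t) = vertexAt-end t

  vertexAt-~ : ∀ {k a b c d} (t : Trail k a b c d) {i} → i ℕ.< k →
               vertexAt t i ~ vertexAt t (suc i)
  vertexAt-~ (edge a~b)     {zero}  _ = a~b
  vertexAt-~ (edge a~b)     {suc i} (ℕ.s≤s ())
  vertexAt-~ (cons a~b _ t) {zero}  _ rewrite vertexAt-0 t = a~b
  vertexAt-~ (cons _ _ t)   {suc i} (ℕ.s≤s i<k) = vertexAt-~ t i<k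

  vertexAt-≢ : ∀ {k a b c d} (t : Trail k a b c d) {i} → suc i ℕ.< k →
               vertexAt t i ≢ vertexAt t (suc (suc i))
  vertexAt-≢ (edge _)       (ℕ.s≤s ())
  vertexAt-≢ (cons _ a≢c t) {zero}  _ rewrite vertexAt-1 t = a≢c
  vertexAt-≢ (cons _ _ t)   {suc i} (ℕ.s≤s i<k) = vertexAt-≢ t i<k

  positive-length : ∀ {k a b c d} → Trail k a b c d → 0 ℕ.< k
  positive-length (edge _)     = ℕ.s≤s ℕ.z≤n
  positive-length (cons _ _ _) = ℕ.s≤s ℕ.z≤n

  -- The first repetition along a closed non-backtracking walk bounds a cycle.
  closed-trail⇒cycle : ∀ {k a b c} → Trail k a b c a → ∃[ n ] (n ℕ.≤ k × HasCycle n G)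
  closed-trail⇒cycle {k} trail
    with least (λ j → ℕ.anyUpTo? (λ i → u i Fin.≟ u j) j) k
               (0 , positive-length trail , ≡.trans (vertexAt-0 trail) (≡.sym (vertexAt-end trail)))
    where u = vertexAt trail
  ... | j , (i , i<j , uᵢ≡uⱼ) , first with ℕ.m≤n⇒∃[o]m+o≡n (ℕ.<⇒≤ i<j)
  ...   | n , ≡.refl = n , ℕ.≤-trans (ℕ.m≤n+m n i) j≤k , long n ≡.refl , f , f-injective , λ where
      (inj₁ next) → f-next next
      (inj₂ next) → ~-sym (f-next next)
    where
    u : ℕ → Vertex
    u = vertexAt trail
    j≤k : i ℕ.+ n ℕ.≤ k
    j≤k = first k (0 , positive-length trail , ≡.trans (vertexAt-0 trail) (≡.sym (vertexAt-end trail)))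
    -- Between the two equal positions, length 0 contradicts `i < j`, length 1 would be a loop, and
    -- length 2 would be a backtrack.
    long : ∀ n′ → n ≡ n′ → 3 ℕ.≤ n′
    long 0 ≡.refl = ⊥-elim (ℕ.<-irrefl (≡.sym (ℕ.+-identityʳ i)) i<j)
    long 1 ≡.refl = ⊥-elim (~-irrefl (≡.trans uᵢ≡uⱼ (≡.cong u (ℕ.+-comm i 1)))
      (vertexAt-~ trail (≡.subst (ℕ._≤ k) (ℕ.+-comm i 1) j≤k)))
    long 2 ≡.refl = ⊥-elim (vertexAt-≢ trail (≡.subst (ℕ._≤ k) (ℕ.+-comm i 2) j≤k)
      (≡.trans uᵢ≡uⱼ (≡.cong u (ℕ.+-comm i 2))))
    long (suc (suc (suc _))) _ = ℕ.s≤s (ℕ.s≤s (ℕ.s≤s ℕ.z≤n))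
    f : Fin n → Vertex
    f a = u (i ℕ.+ toℕ a)
    before : ∀ (a : Fin n) → i ℕ.+ toℕ a ℕ.< i ℕ.+ n
    before a = ℕ.+-monoʳ-< i (Fin.toℕ<n a)
    no-repeat : ∀ {a b : Fin n} → toℕ a ℕ.< toℕ b → f a ≢ f b
    no-repeat {a} {b} a<b fa≡fb = ℕ.<⇒≱ (before b)
      (first (i ℕ.+ toℕ b) (i ℕ.+ toℕ a , ℕ.+-monoʳ-< i a<b , fa≡fb))
    f-injective : Injective _≡_ _≡_ f
    f-injective {a} {b} fa≡fb with ℕ.<-cmp (toℕ a) (toℕ b)
    ... | tri< a<b _ _ = ⊥-elim (no-repeat a<b fa≡fb)
    ... | tri≈ _ a≡b _ = Fin.toℕ-injective a≡b
    ... | tri> _ _ b<a = ⊥-elim (no-repeat b<a (≡.sym fa≡fb))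
    f-step : ∀ a {v} → u (i ℕ.+ suc (toℕ a)) ≡ v → f a ~ v
    f-step a ≡.refl = ≡.subst (λ k → f a ~ u k) (≡.sym (ℕ.+-suc i (toℕ a)))
      (vertexAt-~ trail (ℕ.<-≤-trans (before a) j≤k))
    f-next : ∀ {a b} → Next n a b → f a ~ f b
    f-next {a} (inj₁ b≡1+a)         = f-step a (≡.cong (λ k → u (i ℕ.+ k)) (≡.sym b≡1+a))
    -- The closing edge leads to position `i + n`, which carries the same vertex as position `i`.
    f-next {a} (inj₂ (n≡1+a , b≡0)) = f-step a (≡.trans
      (≡.cong (λ k → u (i ℕ.+ k)) (≡.sym n≡1+a))
      (≡.trans (≡.sym uᵢ≡uⱼ) (≡.cong u (≡.sym (≡.trans (≡.cong (i ℕ.+_) b≡0) (ℕ.+-identityʳ i))))))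

  module _ (girth : Girth≥ 6 G) where

    no-short-trail : ∀ {k a b c} → k ℕ.≤ 5 → ¬ Trail k a b c a
    no-short-trail k≤5 trail with closed-trail⇒cycle trail
    ... | n , n≤k , cycle = ℕ.<⇒≱ (ℕ.s≤s (ℕ.≤-trans n≤k k≤5)) (girth n cycle)

    private
      ≢-~ : ∀ {a b} → a ~ b → a ≢ b
      ≢-~ a~b a≡b = ~-irrefl a≡b a~b

    no-triangle : ∀ {a b c} → a ~ b → b ~ c → c ~ a → ⊥
    no-triangle a~b b~c c~a = no-short-trail (ℕ.m≤m+n 3 2)
      (cons a~b (≢-~ c~a ∘ ≡.sym) (cons b~c (≢-~ a~b ∘ ≡.sym) (edge c~a)))

    no-square : ∀ {a b c d} → a ~ b → b ~ c → c ~ d → d ~ a → a ≢ c → b ≢ d → ⊥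
    no-square a~b b~c c~d d~a a≢c b≢d = no-short-trail (ℕ.m≤m+n 4 1)
      (cons a~b a≢c (cons b~c b≢d (cons c~d (a≢c ∘ ≡.sym) (edge d~a))))

    no-pentagon : ∀ {a b c d e} → a ~ b → b ~ c → c ~ d → d ~ e → e ~ a →
                  a ≢ c → b ≢ d → c ≢ e → d ≢ a → ⊥
    no-pentagon a~b b~c c~d d~e e~a a≢c b≢d c≢e d≢a = no-short-trail ℕ.≤-refl
      (cons a~b a≢c (cons b~c b≢d (cons c~d c≢e (cons d~e d≢a (edge e~a)))))

    module _ {x y : Vertex} (x~y : x ~ y) where
      private
        y~x : y ~ x
        y~x = ~-sym x~y

        Behind : Vertex → Set
        Behind z = ∃[ u ] (x ~ u × u ≢ y × u ~ z)

        -- The distance from the neighbours of `x` other than `y`, capped at 2, with the neighbours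
        -- of `y` other than `x` lifted to 3 and the heights of `x` and `y` fixed even when `x` has
        -- no other neighbour.
        data HasHeight (z : Vertex) : ℕ → Set where
          head : z ≡ y → HasHeight z 2
          tail : z ≡ x → HasHeight z 1
          inn  : x ~ z → z ≢ y → HasHeight z 0
          out  : y ~ z → z ≢ x → HasHeight z 3
          near : z ≢ x → z ≢ y → ¬ x ~ z → ¬ y ~ z → Behind z → HasHeight z 1
          far  : z ≢ x → z ≢ y → ¬ x ~ z → ¬ y ~ z → ¬ Behind z → HasHeight z 2

        level : ∀ z → ∃ (HasHeight z)
        level z with z Fin.≟ x | z Fin.≟ y
        ... | yes z≡x | _       = 1 , tail z≡x
        ... | no  _   | yes z≡y = 2 , head z≡y
        ... | no  z≢x | no  z≢y with x ~? z | y ~? z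
        ...   | yes x~z | _       = 0 , inn x~z z≢y
        ...   | no  _   | yes y~z = 3 , out y~z z≢x
        ...   | no  x≁z | no  y≁z
                with Fin.any? (λ u → (x ~? u) ×-dec ¬? (u Fin.≟ y) ×-dec (u ~? z))
        ...     | yes b = 1 , near z≢x z≢y x≁z y≁z b
        ...     | no ¬b = 2 , far z≢x z≢y x≁z y≁z ¬b

        level≤3 : ∀ {z i} → HasHeight z i → i ℕ.≤ 3
        level≤3 (head _)         = ℕ.m≤m+n 2 1
        level≤3 (tail _)         = ℕ.m≤m+n 1 2
        level≤3 (inn _ _)        = ℕ.z≤n
        level≤3 (out _ _)        = ℕ.≤-refl
        level≤3 (near _ _ _ _ _) = ℕ.m≤m+n 1 2
        level≤3 (far _ _ _ _ _)  = ℕ.m≤m+n 2 1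

        -- An edge could rise by two or more only from height 0 or from height 1 to 3. From `inn`,
        -- reaching `head` closes a triangle, reaching `out` a square, and reaching `far`
        -- contradicts its definition; reaching `out` from `tail` closes a triangle and from `near`
        -- a pentagon.
        level-lipschitz : ∀ {a b i j} → a ~ b → HasHeight a i → HasHeight b j → j ℕ.≤ suc i
        level-lipschitz a~b (out _ _)  lb = ℕ.≤-trans (level≤3 lb) (ℕ.n≤1+n 3)
        level-lipschitz a~b (head _)   lb = level≤3 lb
        level-lipschitz a~b (far _ _ _ _ _) lb = level≤3 lb
        level-lipschitz a~b (inn x~a a≢y) (head ≡.refl) = ⊥-elim (no-triangle x~a a~b y~x)
        level-lipschitz a~b (inn x~a a≢y) (tail _) = ℕ.≤-refl
        level-lipschitz a~b (inn x~a a≢y) (inn _ _) = ℕ.z≤n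
        level-lipschitz a~b (inn x~a a≢y) (out y~b b≢x) =
          ⊥-elim (no-square x~a a~b (~-sym y~b) y~x (b≢x ∘ ≡.sym) a≢y)
        level-lipschitz a~b (inn x~a a≢y) (near _ _ _ _ _) = ℕ.≤-refl
        level-lipschitz a~b (inn x~a a≢y) (far _ _ _ _ ¬b) = ⊥-elim (¬b (_ , x~a , a≢y , a~b))
        level-lipschitz a~b (tail ≡.refl) (out y~b _) = ⊥-elim (no-triangle a~b (~-sym y~b) y~x)
        level-lipschitz a~b (near a≢x a≢y _ _ (u , x~u , u≢y , u~a)) (out y~b b≢x) =
          ⊥-elim (no-pentagon x~u u~a a~b (~-sym y~b) y~x (a≢x ∘ ≡.sym) u≢b a≢y b≢x)
          where
          u≢b : u ≢ _
          u≢b ≡.refl = no-triangle x~u (~-sym y~b) y~x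
        level-lipschitz a~b (tail _) (head _)        = ℕ.≤-refl
        level-lipschitz a~b (tail _) (tail _)        = ℕ.s≤s ℕ.z≤n
        level-lipschitz a~b (tail _) (inn _ _)       = ℕ.z≤n
        level-lipschitz a~b (tail _) (near _ _ _ _ _) = ℕ.s≤s ℕ.z≤n
        level-lipschitz a~b (tail _) (far _ _ _ _ _) = ℕ.≤-refl
        level-lipschitz a~b (near _ _ _ _ _) (head _)        = ℕ.≤-refl
        level-lipschitz a~b (near _ _ _ _ _) (tail _)        = ℕ.s≤s ℕ.z≤n
        level-lipschitz a~b (near _ _ _ _ _) (inn _ _)       = ℕ.z≤n
        level-lipschitz a~b (near _ _ _ _ _) (near _ _ _ _ _) = ℕ.s≤s ℕ.z≤n
        level-lipschitz a~b (near _ _ _ _ _) (far _ _ _ _ _) = ℕ.≤-refl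

        level-tail : ∀ {i} → HasHeight x i → i ≡ 1
        level-tail (head x≡y)         = ⊥-elim (~-irrefl x≡y x~y)
        level-tail (tail _)           = ≡.refl
        level-tail (inn x~x _)        = ⊥-elim (~-irrefl ≡.refl x~x)
        level-tail (out _ x≢x)        = ⊥-elim (x≢x ≡.refl)
        level-tail (near x≢x _ _ _ _) = ⊥-elim (x≢x ≡.refl)
        level-tail (far x≢x _ _ _ _)  = ⊥-elim (x≢x ≡.refl)

        level-head : ∀ {i} → HasHeight y i → i ≡ 2
        level-head (head _)           = ≡.refl
        level-head (tail y≡x)         = ⊥-elim (~-irrefl y≡x y~x)
        level-head (inn _ y≢y)        = ⊥-elim (y≢y ≡.refl)
        level-head (out y~y _)        = ⊥-elim (~-irrefl ≡.refl y~y)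
        level-head (near _ y≢y _ _ _) = ⊥-elim (y≢y ≡.refl)
        level-head (far _ y≢y _ _ _)  = ⊥-elim (y≢y ≡.refl)

        level-in : ∀ {u i} → x ~ u → u ≢ y → HasHeight u i → i ≡ 0
        level-in x~u u≢y (head u≡y)         = ⊥-elim (u≢y u≡y)
        level-in x~u u≢y (tail ≡.refl)      = ⊥-elim (~-irrefl ≡.refl x~u)
        level-in x~u u≢y (inn _ _)          = ≡.refl
        level-in x~u u≢y (out y~u _)        = ⊥-elim (no-triangle x~u (~-sym y~u) y~x)
        level-in x~u u≢y (near _ _ x≁u _ _) = ⊥-elim (x≁u x~u)
        level-in x~u u≢y (far _ _ x≁u _ _)  = ⊥-elim (x≁u x~u)

        level-out : ∀ {v i} → y ~ v → v ≢ x → HasHeight v i → i ≡ 3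
        level-out y~v v≢x (head ≡.refl)      = ⊥-elim (~-irrefl ≡.refl y~v)
        level-out y~v v≢x (tail v≡x)         = ⊥-elim (v≢x v≡x)
        level-out y~v v≢x (inn x~v _)        = ⊥-elim (no-triangle x~v (~-sym y~v) y~x)
        level-out y~v v≢x (out _ _)          = ≡.refl
        level-out y~v v≢x (near _ _ _ y≁v _) = ⊥-elim (y≁v y~v)
        level-out y~v v≢x (far _ _ _ y≁v _)  = ⊥-elim (y≁v y~v)

      potential : Potential G x y
      potential = record
        { height      = λ z → proj₁ (level z)
        ; lipschitz   = λ {a} {b} a~b → level-lipschitz a~b (proj₂ (level a)) (proj₂ (level b))
        ; height-tail = level-tail (proj₂ (level x))
        ; height-head = level-head (proj₂ (level y))
        ; height-in   = λ x~u u≢y → level-in x~u u≢y (proj₂ (level _))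
        ; height-out  = λ y~v v≢x → level-out y~v v≢x (proj₂ (level _))
        }

  module _ (conn : Connected G) where
    open Connected conn using () renaming (nonempty to root)

    depth : Vertex → ℕ
    depth x = dist G conn x root

    private
      depth-0 : ∀ {x} → depth x ℕ.≤ 0 → x ≡ root
      depth-0 {x} d≤0 with dist G conn x root | dist-walk G conn x root
      ... | zero | x≡root = x≡root

      parent : ∀ {x} → x ≢ root → ∃[ z ] (x ~ z × depth z ℕ.< depth x)
      parent {x} x≢root with dist G conn x root | dist-walk G conn x root
      ... | zero  | x≡root         = ⊥-elim (x≢root x≡root)
      ... | suc k | z , x~z , walk = z , x~z , ℕ.s≤s (dist-min G conn k walk)

      parent-of-deeper : ∀ {x y} → x ≢ y → depth y ℕ.≤ depth x →
                         ∃[ z ] (x ~ z × depth z ℕ.< depth x)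
      parent-of-deeper {x} {y} x≢y y≤x = parent λ { ≡.refl → x≢y
        (≡.sym (depth-0 (ℕ.≤-trans y≤x (dist-min G conn 0 ≡.refl)))) }

      shallower≢ : ∀ {x y z} → depth z ℕ.< depth x → depth x ℕ.≤ depth y → z ≢ y
      shallower≢ z<x x≤y ≡.refl = ℕ.<⇒≱ z<x x≤y

      -- Prolong the deeper end towards the root until both ends meet.
      close-trail : ∀ fuel {k a b c d} → Trail k a b c d →
        depth a ℕ.≤ depth b → depth d ℕ.≤ depth c → depth a ℕ.+ depth d ℕ.≤ fuel →
        ∃[ n ] HasCycle n G
      close-trail fuel {a = a} {d = d} t a≤b d≤c ≤fuel with a Fin.≟ d
      ... | yes ≡.refl with n , _ , cycle ← closed-trail⇒cycle t = n , cycle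
      close-trail fuel {a = a} {d = d} t a≤b d≤c ≤fuel | no a≢d with ℕ.≤-total (depth d) (depth a)
      close-trail zero    {a = a} {d = d} t a≤b d≤c ≤fuel | no a≢d | inj₁ d≤a
        with z , _ , z<a ← parent-of-deeper a≢d d≤a =
        ⊥-elim (ℕ.<⇒≱ z<a (ℕ.≤-trans (ℕ.m+n≤o⇒m≤o (depth a) ≤fuel) ℕ.z≤n))
      close-trail zero    {a = a} {d = d} t a≤b d≤c ≤fuel | no a≢d | inj₂ a≤d
        with z , _ , z<d ← parent-of-deeper (a≢d ∘ ≡.sym) a≤d =
        ⊥-elim (ℕ.<⇒≱ z<d (ℕ.≤-trans (ℕ.m+n≤o⇒n≤o (depth a) ≤fuel) ℕ.z≤n))
      close-trail (suc fuel) {a = a} {d = d} t a≤b d≤c ≤fuel | no a≢d | inj₁ d≤a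
        with z , a~z , z<a ← parent-of-deeper a≢d d≤a =
        -- The parent `z` is shallower than `a`, hence than its trail neighbour, so the longer trail
        -- does not backtrack; the depths of the two ends, summed, have dropped.
        close-trail fuel (cons (~-sym a~z) (shallower≢ z<a a≤b) t) (ℕ.<⇒≤ z<a) d≤c
          (ℕ.s≤s⁻¹ (ℕ.≤-trans (ℕ.+-monoˡ-< (depth d) z<a) ≤fuel))
      close-trail (suc fuel) {a = a} {d = d} t a≤b d≤c ≤fuel | no a≢d | inj₂ a≤d
        with z , d~z , z<d ← parent-of-deeper (a≢d ∘ ≡.sym) a≤d =
        close-trail fuel (snoc t d~z (shallower≢ z<d d≤c ∘ ≡.sym)) a≤b (ℕ.<⇒≤ z<d)
          (ℕ.s≤s⁻¹ (ℕ.≤-trans (ℕ.+-monoʳ-< (depth a) z<d) ≤fuel))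

    -- Two such neighbours would give the trail `y`, `x`, `z`, whose ends are no deeper than its
    -- middle and which therefore closes up to a cycle. The comparisons are non-strict because
    -- `RankWeight` orients edges that way.
    tree-parent-unique : (∀ n → ¬ HasCycle n G) → ∀ {x y z} → x ~ y → x ~ z →
      depth y ℕ.≤ depth x → depth z ℕ.≤ depth x → y ≡ z
    tree-parent-unique acyclic {x} {y} {z} x~y x~z y≤x z≤x with y Fin.≟ z
    ... | yes y≡z = y≡z
    ... | no  y≢z with n , cycle ← close-trail _ (cons (~-sym x~y) y≢z (edge x~z)) y≤x z≤x ℕ.≤-refl =
      ⊥-elim (acyclic n cycle)

  private
    IsCycle : ∀ {n} → 3 ℕ.≤ n → (Fin n → Vertex) → Set
    IsCycle {n} 3≤n f = Injective _≡_ _≡_ f × (∀ {i j} → Graph._~_ (C n 3≤n) i j → f i ~ f j)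

    isCycle? : ∀ {n} (3≤n : 3 ℕ.≤ n) f → Dec (IsCycle 3≤n f)
    isCycle? {n} 3≤n f =
      map′ (λ inj {i} {j} → inj i j) (λ inj i j → inj {i} {j})
        (Fin.all? λ i → Fin.all? λ j → (f i Fin.≟ f j) →-dec (i Fin.≟ j))
      ×-dec
      map′ (λ hom {i} {j} → hom i j) (λ hom i j → hom {i} {j})
        (Fin.all? λ i → Fin.all? λ j → Graph._~?_ (C n 3≤n) i j →-dec (f i ~? f j))

    isCycle-≗ : ∀ {n} {3≤n : 3 ℕ.≤ n} {f g} → (∀ i → g i ≡ f i) → IsCycle 3≤n f → IsCycle 3≤n g
    isCycle-≗ g≗f (inj , hom) =
        (λ {i} {j} gi≡gj → inj (≡.trans (≡.sym (g≗f i)) (≡.trans gi≡gj (g≗f j))))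
      , (λ {i} {j} i~j → ≡.subst₂ _~_ (≡.sym (g≗f i)) (≡.sym (g≗f j)) (hom i~j))

  -- A search over all maps `Fin n → Vertex`, coded as numbers by `Fin.funToFin`; decoding returns a
  -- map only up to pointwise equality, whence `isCycle-≗`.
  hasCycle? : ∀ n → Dec (HasCycle n G)
  hasCycle? n with 3 ℕ.≤? n
  ... | no  3≰n = no λ { (3≤n , _) → 3≰n 3≤n }
  ... | yes 3≤n = map′
    (λ { (k , cycle) → 3≤n , Fin.finToFun k , cycle })
    -- Adjacency in `C n` does not mention the proof of `3 ≤ n`, so `hom` transfers between the two
    -- proofs unchanged.
    (λ { (3≤n′ , f , inj , hom) → Fin.funToFin f , isCycle-≗ {3≤n = 3≤n} (Fin.finToFun-funToFin f)
           (inj , λ {i} {j} i~j → hom i~j) })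
    (Fin.any? λ k → isCycle? 3≤n (Fin.finToFun {order} {n} k))

  cycle-length≤order : ∀ {n} → HasCycle n G → n ℕ.≤ order
  cycle-length≤order (_ , f , inj , _) = Fin.injective⇒≤ inj

  anyCycle? : Dec (∃[ n ] HasCycle n G)
  anyCycle? = map′ (λ { (n , _ , cycle) → n , cycle })
    (λ { (n , cycle) → n , ℕ.s≤s (cycle-length≤order cycle) , cycle })
    (ℕ.anyUpTo? hasCycle? (suc order))

  -- No walk can leave the image of `f`, so connectedness makes `f` surjective; saturation moreover
  -- traces every edge of `G` back to an edge of `C n`.
  saturated-cycle⇒cycleGraph : Connected G → ∀ {n} (3≤n : 3 ℕ.≤ n) {f : Fin n → Vertex} →
    Injective _≡_ _≡_ f → (∀ {i j} → Graph._~_ (C n 3≤n) i j → f i ~ f j) →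
    (∀ i {y} → f i ~ y → ∃[ j ] (Graph._~_ (C n 3≤n) i j × f j ≡ y)) →
    IsCycleGraph n G
  saturated-cycle⇒cycleGraph conn {n} 3≤n {f} inj hom saturated =
    3≤n , mk↔ₛ′ index f (λ i → inj (f-index (f i))) f-index , λ x y → mk⇔ index-~ index⁻¹-~
    where
    reach : ∀ k {i y} → Walk k (f i) y → ∃[ j ] f j ≡ y
    reach zero    fi≡y             = _ , fi≡y
    reach (suc k) {i} (z , fi~z , walk) with j , _ , ≡.refl ← saturated i fi~z = reach k walk
    start : Fin n
    start = Fin.fromℕ< (ℕ.≤-trans (ℕ.s≤s ℕ.z≤n) 3≤n)
    preimage : ∀ y → ∃[ j ] f j ≡ y
    preimage y = let k , walk = Connected.walk conn (f start) y in reach k walk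
    index : Vertex → Fin n
    index y = proj₁ (preimage y)
    f-index : ∀ y → f (index y) ≡ y
    f-index y = proj₂ (preimage y)
    index-~ : ∀ {x y} → x ~ y → Graph._~_ (C n 3≤n) (index x) (index y)
    index-~ {x} {y} x~y
      with j , i~j , fj≡y ← saturated (index x) (≡.subst (_~ y) (≡.sym (f-index x)) x~y)
      rewrite inj (≡.trans (f-index y) (≡.sym fj≡y)) = i~j
    index⁻¹-~ : ∀ {x y} → Graph._~_ (C n 3≤n) (index x) (index y) → x ~ y
    index⁻¹-~ {x} {y} i~j = ≡.subst₂ _~_ (f-index x) (f-index y) (hom i~j)

-- Successors around a cycle

module _ {n : ℕ} where

  next : ∀ i → ∃[ j ] Next n i j
  next i with suc (toℕ i) ℕ.<? n
  ... | yes 1+i<n = Fin.fromℕ< 1+i<n , inj₁ (Fin.toℕ-fromℕ< 1+i<n)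
  ... | no  1+i≮n = Fin.fromℕ< 0<n , inj₂ (ℕ.≤-antisym (ℕ.≮⇒≥ 1+i≮n) (Fin.toℕ<n i) , Fin.toℕ-fromℕ< 0<n)
    where
    0<n : 0 ℕ.< n
    0<n = ℕ.≤-<-trans ℕ.z≤n (Fin.toℕ<n i)

  next-functional : ∀ {i j k} → Next n i j → Next n i k → j ≡ k
  next-functional (inj₁ j≡) (inj₁ k≡) = Fin.toℕ-injective (≡.trans j≡ (≡.sym k≡))
  next-functional {j = j} (inj₁ j≡) (inj₂ (n≡ , _)) =
    ⊥-elim (ℕ.<-irrefl (≡.trans j≡ (≡.sym n≡)) (Fin.toℕ<n j))
  next-functional {k = k} (inj₂ (n≡ , _)) (inj₁ k≡) =
    ⊥-elim (ℕ.<-irrefl (≡.trans k≡ (≡.sym n≡)) (Fin.toℕ<n k))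
  next-functional (inj₂ (_ , j≡)) (inj₂ (_ , k≡)) = Fin.toℕ-injective (≡.trans j≡ (≡.sym k≡))

  next-injective : ∀ {i j k} → Next n i k → Next n j k → i ≡ j
  next-injective (inj₁ k≡) (inj₁ k≡′) = Fin.toℕ-injective (ℕ.suc-injective (≡.trans (≡.sym k≡) k≡′))
  next-injective (inj₁ k≡) (inj₂ (_ , k≡0)) with () ← ≡.trans (≡.sym k≡) k≡0
  next-injective (inj₂ (_ , k≡0)) (inj₁ k≡) with () ← ≡.trans (≡.sym k≡) k≡0
  next-injective (inj₂ (n≡ , _)) (inj₂ (n≡′ , _)) =
    Fin.toℕ-injective (ℕ.suc-injective (≡.trans (≡.sym n≡) n≡′))

  -- In a cycle of length 2 the successor is also the predecessor; from length 3 on, the two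
  -- neighbours of a cycle vertex are distinct.
  next-asym : 3 ℕ.≤ n → ∀ {i j} → Next n i j → ¬ Next n j i
  next-asym 3≤n {i} (inj₁ j≡) (inj₁ i≡) =
    ℕ.<⇒≢ (ℕ.m≤n+m (suc (toℕ i)) 1) (≡.trans i≡ (≡.cong suc j≡))
  next-asym 3≤n (inj₁ j≡) (inj₂ (n≡ , i≡0)) = ℕ.<⇒≱ 3≤n
    (ℕ.≤-reflexive (≡.trans n≡ (≡.cong suc (≡.trans j≡ (≡.cong suc i≡0)))))
  next-asym 3≤n (inj₂ (n≡ , j≡0)) (inj₁ i≡) = ℕ.<⇒≱ 3≤n
    (ℕ.≤-reflexive (≡.trans n≡ (≡.cong suc (≡.trans i≡ (≡.cong suc j≡0)))))
  next-asym 3≤n (inj₂ (n≡ , j≡0)) (inj₂ (n≡′ , i≡0)) = ℕ.<⇒≱ 3≤n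
    (ℕ.≤-trans (ℕ.≤-reflexive (≡.trans n≡ (≡.cong suc i≡0))) (ℕ.s≤s ℕ.z≤n))

previous : ∀ {n} j → ∃[ i ] Next n i j
previous {suc m} zero    = Fin.fromℕ m , inj₂ (≡.cong suc (≡.sym (Fin.toℕ-fromℕ m)) , ≡.refl)
previous {suc m} (suc j) = Fin.inject₁ j , inj₁ (≡.cong suc (≡.sym (Fin.toℕ-inject₁ j)))

next-inject₁ : ∀ {m} (i : Fin m) → Next (suc m) (Fin.inject₁ i) (suc i)
next-inject₁ i = proj₂ (previous (suc i))

next-fromℕ : ∀ m → Next (suc m) (Fin.fromℕ m) zero
next-fromℕ m = proj₂ (previous zero)

bounded : ∀ {n} (f : Fin n → ℕ) → ∃[ k ] (∀ i → f i ℕ.≤ k)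
bounded {zero}  f = 0 , λ ()
bounded {suc n} f with k , f≤k ← bounded (f ∘ suc) = f zero ℕ.⊔ k , λ where
  zero    → ℕ.m≤m⊔n (f zero) k
  (suc i) → ℕ.≤-trans (f≤k i) (ℕ.m≤n⊔m (f zero) k)

-- The curvature criterion and rigidity of cycles

module Curvature (ℝ : Reals) (G : Graph) (𝓌 : Weight ℝ G) where
  open Reals ℝ hiding (zero)
  open OrderedField ℝ
  open Graph G
  open Weight 𝓌
  open Transition ℝ G 𝓌

  Nonnegative : Set
  Nonnegative = ∀ {x y} → x ~ y → 1# ≤ p x y + p y x

  module _ (conn : Connected G) (girth : Girth≥ 6 G) where
    open Transport ℝ G conn
    open Cycles G using (potential)

    admissible⇒nonnegative : Admissible ℝ G conn 𝓌 → Nonnegative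
    admissible⇒nonnegative admissible {x} {y} x~y =
      let l , l-limit , 0≤l = admissible x y x~y
          0≤excess = ≤-trans 0≤l (κLLY≤excess 𝓌 x~y (potential girth x~y) l-limit)
          0≤p+q-1 = *-cancelˡ-≤ _ 0<2 (≤-trans (≤-reflexive (zeroʳ _)) 0≤excess)
      in ≤-by 0≤p+q-1 (solve 1 (λ s → s := con (+ 1) :+ (s :- con (+ 1))) ≈-refl (p x y + p y x))

    nonnegative⇒admissible : Nonnegative → Admissible ℝ G conn 𝓌
    nonnegative⇒admissible nonneg x y x~y =
      _ , IsκLLY-excess 𝓌 x~y (potential girth x~y) , *-nonneg (<⇒≤ 0<2) (x≤y⇒0≤y-x (nonneg x~y))

  -- Around a cycle the probability of stepping forward cannot increase, and it
  -- drops at any vertex with a further neighbour.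
  cycle-saturated : Nonnegative → ∀ {n} (3≤n : 3 ℕ.≤ n) {f : Fin n → Vertex} →
    Injective _≡_ _≡_ f → (∀ {i j} → Graph._~_ (C n 3≤n) i j → f i ~ f j) →
    ∀ i {y} → f i ~ y → ∃[ j ] (Graph._~_ (C n 3≤n) i j × f j ≡ y)
  cycle-saturated nonneg {suc m} 3≤n {f} inj hom i {y} fi~y
    with h , h→i ← previous i | j , i→j ← next i
    with f h Fin.≟ y | f j Fin.≟ y
  ... | yes fh≡y | _        = h , inj₂ h→i , fh≡y
  ... | no  _    | yes fj≡y = j , inj₁ i→j , fj≡y
  ... | no  fh≢y | no  fj≢y = ⊥-elim (<⇒≱ drop (begin
      forward h          ≤⟨ from-0 h ⟩
      forward zero       ≤⟨ to-0 i ⟩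
      forward i          ∎))
    where
    open ≤-Reasoning
    step : ∀ {i j} → Next (suc m) i j → f i ~ f j
    step = hom ∘ inj₁
    forward : Fin (suc m) → Carrier
    forward i = p (f i) (f (proj₁ (next i)))
    forward≈ : ∀ {i j} → Next (suc m) i j → forward i ≡ p (f i) (f j)
    forward≈ {i} i→j = ≡.cong (λ j → p (f i) (f j)) (next-functional (proj₂ (next i)) i→j)
    h≢j : ∀ {h i j} → Next (suc m) h i → Next (suc m) i j → f h ≢ f j
    h≢j h→i i→j fh≡fj with ≡.refl ← inj fh≡fj = next-asym 3≤n h→i i→j
    1-back : ∀ {h i} → Next (suc m) h i → 1# - p (f i) (f h) ≤ p (f h) (f i)
    1-back {h} {i} h→i = ≤-by (x≤y⇒0≤y-x (nonneg (step h→i)))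
      (solve 2 (λ a b → let one = con (+ 1) in a := (one :- b) :+ (a :+ b :- one))
        ≈-refl (p (f h) (f i)) (p (f i) (f h)))
    antitone : ∀ {h i} → Next (suc m) h i → forward i ≤ forward h
    antitone {h} {i} h→i with j , i→j ← next i = begin
      p (f i) (f j)                   ≤⟨ ≤-by (x≤y⇒0≤y-x two≤1) (solve 2 (λ a b → let one = con (+ 1) in
                                           one :- a := b :+ (one :- (a :+ b)))
                                           ≈-refl (p (f i) (f h)) (p (f i) (f j))) ⟩
      1# - p (f i) (f h)              ≤⟨ 1-back h→i ⟩
      p (f h) (f i)                   ≡⟨ forward≈ h→i ⟨
      forward h                       ∎
      where
      two≤1 : p (f i) (f h) + p (f i) (f j) ≤ 1#
      two≤1 = ≤-trans (two-terms≤sum (p-nonneg (f i)) (h≢j h→i i→j)) (≤-reflexive (sum-p (step i→j)))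
    -- `forward` decreases weakly from `zero` up to the last index, and the wrap-around edge returns
    -- to `zero`; both inductions together force it to be constant, against `drop`.
    from-0 : ∀ i → forward i ≤ forward zero
    from-0 = Fin.<-weakInduction (λ i → forward i ≤ forward zero) ≤-refl
      λ i ih → ≤-trans (antitone (next-inject₁ i)) ih
    to-0 : ∀ i → forward zero ≤ forward i
    to-0 = Fin.>-weakInduction (λ i → forward zero ≤ forward i) (antitone (next-fromℕ m))
      λ i ih → ≤-trans ih (antitone (next-inject₁ i))
    drop : forward i < forward h
    drop = begin-strict
      forward i                             ≡⟨ forward≈ i→j ⟩
      p (f i) (f j)                         <⟨ <-by (p-pos fi~y) ≈-refl ⟩
      p (f i) (f j) + p (f i) y             ≤⟨ ≤-by (x≤y⇒0≤y-x three≤1)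
                                                 (solve 3 (λ a b c → let one = con (+ 1) in
                                                   one :- a := b :+ c :+ (one :- (a :+ (b :+ c))))
                                                 ≈-refl (p (f i) (f h)) (p (f i) (f j)) (p (f i) y)) ⟩
      1# - p (f i) (f h)                    ≤⟨ 1-back h→i ⟩
      p (f h) (f i)                         ≡⟨ forward≈ h→i ⟨
      forward h                             ∎
      where
      three≤1 : p (f i) (f h) + (p (f i) (f j) + p (f i) y) ≤ 1#
      three≤1 = ≤-trans (three-terms≤sum (p-nonneg (f i)) (h≢j h→i i→j) fh≢y fj≢y)
                        (≤-reflexive (sum-p fi~y))

-- Counting edges by curvature

module _ (ℝ : Reals) where
  open Reals ℝ hiding (zero)
  open OrderedField ℝ

  listSum : ∀ {A : Set} → (A → Carrier) → List A → Carrier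
  listSum f = List.foldr (λ a s → f a + s) 0#

  listSum-++ : ∀ {A : Set} (f : A → Carrier) xs ys → listSum f (xs ++ ys) ≈ listSum f xs + listSum f ys
  listSum-++ f []       ys = ≈-sym (+-identityˡ _)
  listSum-++ f (x ∷ xs) ys = ≈-trans (+-congˡ (listSum-++ f xs ys)) (≈-sym (+-assoc _ _ _))

  listSum-map : ∀ {A B : Set} (f : B → Carrier) (g : A → B) xs →
                listSum f (List.map g xs) ≈ listSum (f ∘ g) xs
  listSum-map f g []       = ≈-refl
  listSum-map f g (x ∷ xs) = +-congˡ (listSum-map f g xs)

  listSum-cong : ∀ {A : Set} {f g : A → Carrier} → (∀ x → f x ≈ g x) → ∀ xs → listSum f xs ≈ listSum g xs
  listSum-cong f≈g []       = ≈-refl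
  listSum-cong f≈g (x ∷ xs) = +-cong (f≈g x) (listSum-cong f≈g xs)

  listSum-cartesianProduct : ∀ {A B : Set} (f : A × B → Carrier) xs ys →
    listSum f (List.cartesianProduct xs ys) ≈ listSum (λ x → listSum (λ y → f (x , y)) ys) xs
  listSum-cartesianProduct f []       ys = ≈-refl
  listSum-cartesianProduct f (x ∷ xs) ys = ≈-trans (listSum-++ f (List.map (x ,_) ys) _)
    (+-cong (listSum-map f (x ,_) ys) (listSum-cartesianProduct f xs ys))

  listSum-tabulate : ∀ {A : Set} {n} (f : A → Carrier) (g : Fin n → A) →
    listSum f (List.tabulate g) ≈ sum (f ∘ g)
  listSum-tabulate {n = zero}  f g = ≈-refl
  listSum-tabulate {n = suc n} f g = +-congˡ (listSum-tabulate f (g ∘ suc))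

  length-filter : ∀ {A : Set} {P : A → Set} (P? : Decidable P) xs →
    List.length (List.filter P? xs) · 1# ≈ listSum (λ x → if does (P? x) then 1# else 0#) xs
  length-filter P? []       = ≈-refl
  length-filter P? (x ∷ xs) with P? x
  ... | yes _ = +-congˡ (length-filter P? xs)
  ... | no  _ = ≈-trans (length-filter P? xs) (≈-sym (+-identityˡ _))

  module _ (G : Graph) where
    open Graph G

    overEdges : (Vertex → Vertex → Carrier) → Vertex → Vertex → Carrier
    overEdges f x y = if does ((x Fin.<? y) ×-dec (x ~? y)) then f x y else 0#

    ∣E∣≈sum : ∣E∣ G · 1# ≈ sum λ x → sum λ y → overEdges (λ _ _ → 1#) x y
    ∣E∣≈sum = begin-equality
      ∣E∣ G · 1#
        ≈⟨ length-filter (λ (x , y) → (x Fin.<? y) ×-dec (x ~? y)) (List.cartesianProduct V V) ⟩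
      listSum (λ (x , y) → overEdges (λ _ _ → 1#) x y) (List.cartesianProduct V V)
        ≈⟨ listSum-cartesianProduct _ V V ⟩
      listSum (λ x → listSum (overEdges (λ _ _ → 1#) x) V) V
        ≈⟨ listSum-cong (λ x → listSum-tabulate (overEdges (λ _ _ → 1#) x) (λ y → y)) V ⟩
      listSum (λ x → sum (overEdges (λ _ _ → 1#) x)) V
        ≈⟨ listSum-tabulate (λ x → sum (overEdges (λ _ _ → 1#) x)) (λ x → x) ⟩
      (sum λ x → sum λ y → overEdges (λ _ _ → 1#) x y) ∎
      where
      open ≤-Reasoning
      V = List.allFin order

    module _ (𝓌 : Weight ℝ G) where
      open Weight 𝓌
      open Transition ℝ G 𝓌
      open Curvature ℝ G 𝓌

      private
        defect : Vertex → Vertex → Carrier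
        defect x y = overEdges (λ x y → p x y + p y x - 1#) x y

        up down : Vertex → Vertex → Carrier
        up   x y = if does (x Fin.<? y) then p x y else 0#
        down x y = if does (x Fin.<? y) then p y x else 0#

        overEdges-split : ∀ x y → overEdges (λ _ _ → 1#) x y + defect x y ≈ up x y + down x y
        overEdges-split x y = split (x Fin.<? y) (x ~? y)
          where
          split : (x<?y : Dec (x Fin.< y)) (x~?y : Dec (x ~ y)) →
            (if does (x<?y ×-dec x~?y) then 1# else 0#)
              + (if does (x<?y ×-dec x~?y) then p x y + p y x - 1# else 0#)
            ≈ (if does x<?y then p x y else 0#) + (if does x<?y then p y x else 0#)
          split (no  _) _         = ≈-refl
          split (yes _) (yes _)   =
            solve 1 (λ s → con (+ 1) :+ (s :- con (+ 1)) := s) ≈-refl (p x y + p y x)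
          split (yes _) (no  x≁y) = ≈-sym (+-cong (p-≁ x≁y) (p-≁ (x≁y ∘ ~-sym)))

        up+down : ∀ x y → up x y + down y x ≈ p x y
        up+down x y = split (x Fin.<? y) (y Fin.<? x)
          where
          split : (x<?y : Dec (x Fin.< y)) (y<?x : Dec (y Fin.< x)) →
            (if does x<?y then p x y else 0#) + (if does y<?x then p x y else 0#) ≈ p x y
          split (yes x<y) (yes y<x) = ⊥-elim (ℕ.<-asym x<y y<x)
          split (yes _)   (no  _)   = +-identityʳ _
          split (no  _)   (yes _)   = +-identityˡ _
          split (no  x≮y) (no  y≮x) = ≈-trans (+-identityˡ 0#) (≈-sym (p-≁ (~-irrefl
            (Fin.toℕ-injective (ℕ.≤-antisym (ℕ.≮⇒≥ y≮x) (ℕ.≮⇒≥ x≮y))))))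

        row≤1 : ∀ x → sum (p x) ≤ 1#
        row≤1 x with Fin.any? (x ~?_)
        ... | yes (_ , x~y) = ≤-reflexive (sum-p x~y)
        ... | no  isolated  = ≤-trans (≤-reflexive (sum-zero λ y → p-≁ λ x~y → isolated (y , x~y))) (<⇒≤ 0<1)

        -- The sum of `p x y + p y x` over edges splits into the entries of `p` above and below the
        -- diagonal. Transposing the latter reassembles the whole matrix, whose rows sum to `1#`, or
        -- to `0#` at an isolated vertex, hence `≤`.
        ∣E∣+defect : ∣E∣ G · 1# + (sum λ x → sum λ y → defect x y) ≤ ∣V∣ G · 1#
        ∣E∣+defect = begin
          ∣E∣ G · 1# + (sum λ x → sum λ y → defect x y)
            ≈⟨ +-congʳ ∣E∣≈sum ⟩
          (sum λ x → sum λ y → overEdges (λ _ _ → 1#) x y) + (sum λ x → sum λ y → defect x y)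
            ≈⟨ sum²-distrib-+ (overEdges (λ _ _ → 1#)) defect ⟨
          (sum λ x → sum λ y → overEdges (λ _ _ → 1#) x y + defect x y)
            ≈⟨ (sum-cong-≋ λ x → sum-cong-≋ λ y → overEdges-split x y) ⟩
          (sum λ x → sum λ y → up x y + down x y)
            ≈⟨ sum²-distrib-+ up down ⟩
          (sum λ x → sum λ y → up x y) + (sum λ x → sum λ y → down x y)
            ≈⟨ +-congˡ (∑-comm down) ⟩
          (sum λ x → sum λ y → up x y) + (sum λ x → sum λ y → down y x)
            ≈⟨ sum²-distrib-+ up (λ x y → down y x) ⟨
          (sum λ x → sum λ y → up x y + down y x)
            ≈⟨ (sum-cong-≋ λ x → sum-cong-≋ λ y → up+down x y) ⟩
          (sum λ x → sum (p x))
            ≤⟨ sum-mono-≤ row≤1 ⟩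
          sum {order} (λ _ → 1#)
            ≈⟨ sum-const order 1# ⟩
          ∣V∣ G · 1# ∎
          where
          open ≤-Reasoning
          sum²-distrib-+ : ∀ (f g : Vertex → Vertex → Carrier) →
            (sum λ x → sum λ y → f x y + g x y) ≈ (sum λ x → sum λ y → f x y) + (sum λ x → sum λ y → g x y)
          sum²-distrib-+ f g = ≈-trans (sum-cong-≋ λ x → ∑-distrib-+ (f x) (g x))
                                       (∑-distrib-+ (λ x → sum (f x)) (λ x → sum (g x)))

        defect-nonneg : Nonnegative → ∀ x y → 0# ≤ defect x y
        defect-nonneg nonneg x y = nonneg-on ((x Fin.<? y) ×-dec (x ~? y))
          where
          nonneg-on : (e : Dec (x Fin.< y × x ~ y)) →
            0# ≤ (if does e then p x y + p y x - 1# else 0#)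
          nonneg-on (yes (_ , x~y)) = x≤y⇒0≤y-x (nonneg x~y)
          nonneg-on (no  _)         = ≤-refl

      nonnegative⇒∣E∣≤∣V∣ : Nonnegative → ∣E∣ G ℕ.≤ ∣V∣ G
      nonnegative⇒∣E∣≤∣V∣ nonneg = 1·-cancel-≤ (≤-trans
        (≤-by (sum-nonneg λ x → sum-nonneg (defect-nonneg nonneg x)) ≈-refl) ∣E∣+defect)

      module _ (pos : ∀ {x y} → x ~ y → 1# < p x y + p y x) where

        private
          sorted-edge : ∀ {x y} → x Fin.< y → x ~ y → ∣E∣ G ℕ.< ∣V∣ G
          sorted-edge {x} {y} x<y x~y = ℕ.≰⇒> λ V≤E → <⇒≱
            (<-by 0<defects ≈-refl)
            (≤-trans ∣E∣+defect (·-monoˡ-≤ (<⇒≤ 0<1) V≤E))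
            where
            nonneg : ∀ x y → 0# ≤ defect x y
            nonneg = defect-nonneg λ x~y → <⇒≤ (pos x~y)
            positive-on : (e : Dec (x Fin.< y × x ~ y)) →
              0# < (if does e then p x y + p y x - 1# else 0#)
            positive-on (yes _)  = x<y⇒0<y-x (pos x~y)
            positive-on (no  ¬e) = ⊥-elim (¬e (x<y , x~y))
            0<defects : 0# < sum λ x → sum λ y → defect x y
            0<defects = <-≤-trans (positive-on ((x Fin.<? y) ×-dec (x ~? y))) (≤-trans
              (term≤sum (nonneg x) y) (term≤sum (λ x → sum-nonneg (nonneg x)) x))

        -- For trees this takes the place of a count by removing leaves: one edge makes the total
        -- defect positive. It is first oriented from the smaller endpoint, as `defect` counts it.
        positive⇒∣E∣<∣V∣ : ∀ {x y} → x ~ y → ∣E∣ G ℕ.< ∣V∣ G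
        positive⇒∣E∣<∣V∣ {x} {y} x~y with Fin.<-cmp x y
        ... | tri< x<y _ _ = sorted-edge x<y x~y
        ... | tri≈ _ x≡y _ = ⊥-elim (~-irrefl x≡y x~y)
        ... | tri> _ _ y<x = sorted-edge y<x (~-sym x~y)

-- Admissible weights on trees and on cycles

module RankWeight (ℝ : Reals) (G : Graph) (rank : Graph.Vertex G → ℕ) where
  open Reals ℝ hiding (zero)
  open OrderedField ℝ
  open Graph G

  private
    N : Carrier
    N = order · 1#

    0≤N : 0# ≤ N
    0≤N = ·-nonneg order (<⇒≤ 0<1)

    -- `N * N` bounds the numbers of remaining edges at the two ends; the summand `1#` makes the
    -- resulting inequality strict.
    M : Carrier
    M = 1# + N * N

    0<M : 0# < M
    0<M = +-pos-nonneg 0<1 (*-nonneg 0≤N 0≤N)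

  -- ψ decreases so fast that N² ψ (k + 1) < ψ k ².
  ψ : ℕ → Carrier
  ψ zero    = 1#
  ψ (suc k) = ψ k * (ψ k * M ⁻¹)

  ψ-pos : ∀ k → 0# < ψ k
  ψ-pos zero    = 0<1
  ψ-pos (suc k) = *-pos (ψ-pos k) (*-pos (ψ-pos k) (⁻¹-pos 0<M))

  M*ψ-suc : ∀ k → M * ψ (suc k) ≈ ψ k * ψ k
  M*ψ-suc k = begin-equality
    M * (ψ k * (ψ k * M ⁻¹))    ≈⟨ solve 3 (λ m a i → m :* (a :* (a :* i)) := a :* a :* (m :* i))
                                     ≈-refl M (ψ k) (M ⁻¹) ⟩
    ψ k * ψ k * (M * M ⁻¹)      ≈⟨ *-congˡ (*-inverseʳ M (>⇒≉0 0<M)) ⟩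
    ψ k * ψ k * 1#              ≈⟨ *-identityʳ _ ⟩
    ψ k * ψ k                   ∎
    where open ≤-Reasoning

  ψ-step : ∀ k → ψ k ≤ 1# → ψ (suc k) ≤ ψ k
  ψ-step k ψ≤1 = *-cancelˡ-≤ M 0<M (begin
    M * ψ (suc k)   ≈⟨ M*ψ-suc k ⟩
    ψ k * ψ k       ≤⟨ *-monoʳ-≤ (ψ k) (<⇒≤ (ψ-pos k))
                         (≤-trans ψ≤1 (≤-by (*-nonneg 0≤N 0≤N) ≈-refl)) ⟩
    M * ψ k         ∎)
    where open ≤-Reasoning

  ψ≤1 : ∀ k → ψ k ≤ 1#
  ψ≤1 zero    = ≤-refl
  ψ≤1 (suc k) = ≤-trans (ψ-step k (ψ≤1 k)) (ψ≤1 k)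

  ψ-antitone : ∀ {j k} → j ℕ.≤ k → ψ k ≤ ψ j
  ψ-antitone j≤k = antitone (ℕ.≤⇒≤′ j≤k)
    where
    antitone : ∀ {j k} → j ℕ.≤′ k → ψ k ≤ ψ j
    antitone ℕ.≤′-refl       = ≤-refl
    antitone (ℕ.≤′-step {k} j≤k) = ≤-trans (ψ-step k (ψ≤1 k)) (antitone j≤k)

  -- The rank of the outer endpoint decides. With the depth in a tree the weights decay; with the
  -- constant rank 0 they are all `1#`, which is the case used for cycles.
  rankWeight : Weight ℝ G
  rankWeight = record
    { w        = λ x y → ψ (rank x ℕ.⊔ rank y)
    ; w-sym    = λ {x} {y} _ → reflexive (≡.cong ψ (ℕ.⊔-comm (rank x) (rank y)))
    ; positive = λ {x} {y} _ → ψ-pos (rank x ℕ.⊔ rank y)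
    }

  rankWeight-bounds : ∃[ b ] (0# < b × (∀ x y → b ≤ Weight.w rankWeight x y))
  rankWeight-bounds with k , rank≤k ← bounded rank =
    ψ k , ψ-pos k , λ x y → ψ-antitone (ℕ.⊔-lub (rank≤k x) (rank≤k y))

  open Transition ℝ G rankWeight
  open Weight rankWeight

  private
    d : Vertex → Carrier
    d = degree ℝ G rankWeight

    -- Every vertex is charged `A`, neighbour or not; the generous factor `N` is absorbed by `M`.
    degree-bound : ∀ {x y} A → x ~ y → 0# ≤ A → (∀ {z} → x ~ z → z ≢ y → w x z ≤ A) →
                   d x ≤ w x y + N * A
    degree-bound {x} {y} A x~y 0≤A others≤A = begin
      sum (edgeTerm x)
        ≤⟨ sum-mono-≤ pointwise ⟩
      sum (λ z → only y (w x y) z + A)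
        ≈⟨ ∑-distrib-+ (only y (w x y)) _ ⟩
      sum (only y (w x y)) + sum {order} (λ _ → A)
        ≈⟨ +-cong (sum-only y _) (≈-trans (sum-const order A) (·≈1·* order A)) ⟩
      w x y + N * A ∎
      where
      open ≤-Reasoning
      pointwise : ∀ z → edgeTerm x z ≤ only y (w x y) z + A
      pointwise z with x ~? z | z Fin.≟ y
      ... | no  _   | z≟y        = +-nonneg (only-nonneg′ z≟y) 0≤A
        where
        only-nonneg′ : (z≟y : Dec (z ≡ y)) → 0# ≤ (if does z≟y then w x y else 0#)
        only-nonneg′ (yes _) = <⇒≤ (positive x~y)
        only-nonneg′ (no  _) = ≤-refl
      ... | yes _   | yes ≡.refl = ≤-by 0≤A ≈-refl
      ... | yes x~z | no  z≢y    = ≤-trans (others≤A x~z z≢y) (≤-reflexive (≈-sym (+-identityˡ A)))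

    -- Clearing denominators, p x y + p y x > 1 says that the weights of the
    -- other edges at x and at y have a product below (w x y)².
    positive-curvature : ∀ {x y A B} → x ~ y → 0# ≤ A → d x ≤ w x y + A → d y ≤ w y x + B →
      A * B < w x y * w x y → 1# < p x y + p y x
    positive-curvature {x} {y} {A} {B} x~y 0≤A dx≤ dy≤ AB<ww = ≰⇒> λ p+q≤1 → <⇒≱ AB<ww (begin
      w x y * w x y
        ≈⟨ *-cong (degree*p x~y) (≈-trans (degree*p (~-sym x~y)) (w-sym (~-sym x~y))) ⟨
      (d x * p x y) * (d y * p y x)
        -- Exchanging the two probabilities pairs each degree with the opposite one, and `p + q ≤ 1`
        -- bounds `d x * p y x` by the weight of the other edges at `x`.
        ≈⟨ solve 4 (λ d p e q → (d :* p) :* (e :* q) := (d :* q) :* (e :* p))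
             ≈-refl (d x) (p x y) (d y) (p y x) ⟩
      (d x * p y x) * (d y * p x y)
        ≤⟨ *-monoʳ-≤ _ (*-nonneg (degree-nonneg y) (p-nonneg x y)) (cross x~y dx≤ p+q≤1) ⟩
      A * (d y * p x y)
        ≤⟨ *-monoˡ-≤ A 0≤A (cross (~-sym x~y) dy≤ (≤-trans (≤-reflexive (+-comm _ _)) p+q≤1)) ⟩
      A * B ∎)
      where
      open ≤-Reasoning
      cross : ∀ {x y A} → x ~ y → d x ≤ w x y + A → p x y + p y x ≤ 1# → d x * p y x ≤ A
      cross {x} {y} {A} x~y dx≤ p+q≤1 = begin
        d x * p y x
          ≤⟨ *-monoˡ-≤ (d x) (degree-nonneg x) (≤-by (x≤y⇒0≤y-x p+q≤1)
               (solve 2 (λ p q → let one = con (+ 1) in one :- p := q :+ (one :- (p :+ q)))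
                 ≈-refl (p x y) (p y x))) ⟩
        d x * (1# - p x y)
          ≈⟨ solve 2 (λ d p → d :* (con (+ 1) :- p) := d :- d :* p) ≈-refl (d x) (p x y) ⟩
        d x - d x * p x y
          ≈⟨ +-congˡ (-‿cong (degree*p x~y)) ⟩
        d x - w x y
          ≤⟨ +-monoˡ-≤ _ dx≤ ⟩
        w x y + A - w x y
          ≈⟨ solve 2 (λ w a → w :+ a :- w := a) ≈-refl (w x y) A ⟩
        A ∎

  module _ (unique : ∀ {x y z} → x ~ y → x ~ z → rank y ℕ.≤ rank x → rank z ℕ.≤ rank x → y ≡ z) where

    private
      -- Uniqueness puts every other neighbour of `x` at a rank above `k`, so those edges weigh at
      -- most `ψ (suc k)`; the edges at `y` are bounded merely by `1#`. The edge itself weighs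
      -- `ψ k`, and `M*ψ-suc` closes the gap.
      downward : ∀ {x y} → x ~ y → rank y ℕ.≤ rank x → 1# < p x y + p y x
      downward {x} {y} x~y y≤x = positive-curvature x~y
        (*-nonneg 0≤N (<⇒≤ (ψ-pos (suc k))))
        (degree-bound (ψ (suc k)) x~y (<⇒≤ (ψ-pos (suc k))) λ {z} x~z z≢y → ψ-antitone
          (ℕ.≤-trans (ℕ.≰⇒> (λ z≤x → z≢y (unique x~z x~y z≤x y≤x))) (ℕ.m≤n⊔m k (rank z))))
        (degree-bound 1# (~-sym x~y) (<⇒≤ 0<1) λ {z} _ _ → ψ≤1 (rank y ℕ.⊔ rank z))
        (begin-strict
          (N * ψ (suc k)) * (N * 1#)
            <⟨ <-by (ψ-pos (suc k)) (solve 2 (λ n s → let one = con (+ 1) in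
                 (one :+ n :* n) :* s := (n :* s) :* (n :* one) :+ s) ≈-refl N (ψ (suc k))) ⟩
          M * ψ (suc k)
            ≈⟨ M*ψ-suc k ⟩
          ψ k * ψ k
            ≡⟨ ≡.cong (λ j → ψ j * ψ j) (ℕ.m≥n⇒m⊔n≡m y≤x) ⟨
          w x y * w x y ∎)
        where
        open ≤-Reasoning
        k = rank x

    unique-parent⇒positive-curvature : ∀ {x y} → x ~ y → 1# < p x y + p y x
    unique-parent⇒positive-curvature {x} {y} x~y with ℕ.≤-total (rank y) (rank x)
    ... | inj₁ y≤x = downward x~y y≤x
    ... | inj₂ x≤y = <-respʳ-≈ (+-comm _ _) (downward (~-sym x~y) x≤y)

module CycleWeight (ℝ : Reals) (G : Graph) {n} (cycleGraph : IsCycleGraph n G) where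
  open Reals ℝ hiding (zero)
  open OrderedField ℝ
  open Graph G
  open RankWeight ℝ G (λ _ → 0)
  open Transition ℝ G rankWeight

  private
    open Inverse (proj₁ (proj₂ cycleGraph)) using (to; from; strictlyInverseʳ)

    neighbour₁ neighbour₂ : Vertex → Vertex
    neighbour₁ x = from (proj₁ (next (to x)))
    neighbour₂ x = from (proj₁ (previous (to x)))

    neighbours : ∀ {x y} → x ~ y → (y ≡ neighbour₁ x) ⊎ (y ≡ neighbour₂ x)
    neighbours {x} {y} x~y with Equivalence.to (proj₂ (proj₂ cycleGraph) x y) x~y
    ... | inj₁ x→y = inj₁ (≡.trans (≡.sym (strictlyInverseʳ y))
                       (≡.cong from (next-functional x→y (proj₂ (next (to x))))))
    ... | inj₂ y→x = inj₂ (≡.trans (≡.sym (strictlyInverseʳ y))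
                       (≡.cong from (next-injective y→x (proj₂ (previous (to x))))))

    degree≤2 : ∀ x → degree ℝ G rankWeight x ≤ 1# + 1#
    degree≤2 x = begin
      sum (edgeTerm x)
        ≤⟨ sum-mono-≤ pointwise ⟩
      sum (λ y → only (neighbour₁ x) 1# y + only (neighbour₂ x) 1# y)
        ≈⟨ ∑-distrib-+ (only (neighbour₁ x) 1#) _ ⟩
      sum (only (neighbour₁ x) 1#) + sum (only (neighbour₂ x) 1#)
        ≈⟨ +-cong (sum-only (neighbour₁ x) 1#) (sum-only (neighbour₂ x) 1#) ⟩
      1# + 1# ∎
      where
      open ≤-Reasoning
      pointwise : ∀ y → edgeTerm x y ≤ only (neighbour₁ x) 1# y + only (neighbour₂ x) 1# y
      pointwise y with x ~? y
      ... | no  _   = +-nonneg (only-nonneg (neighbour₁ x) y (<⇒≤ 0<1))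
                               (only-nonneg (neighbour₂ x) y (<⇒≤ 0<1))
      ... | yes x~y with neighbours x~y
      ...   | inj₁ y≡ = ≤-by (only-nonneg (neighbour₂ x) y (<⇒≤ 0<1))
        (+-congʳ (≈-trans (reflexive (≡.cong (only (neighbour₁ x) 1#) y≡)) (only-≡ (neighbour₁ x) 1#)))
      ...   | inj₂ y≡ = ≤-by (only-nonneg (neighbour₁ x) y (<⇒≤ 0<1)) (≈-trans (+-comm _ _)
        (+-congʳ (≈-trans (reflexive (≡.cong (only (neighbour₂ x) 1#) y≡)) (only-≡ (neighbour₂ x) 1#))))

    -- All weights being `1#`, a degree of at most 2 gives each direction probability at least one
    -- half, so the two directions add up to 1.
    half≤p : ∀ {x y} → x ~ y → half ≤ p x y
    half≤p {x} {y} x~y = *-cancelˡ-≤ (1# + 1#) 0<2 (begin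
      (1# + 1#) * half                ≈⟨ *-inverseʳ _ (>⇒≉0 0<2) ⟩
      1#                              ≈⟨ degree*p x~y ⟨
      degree ℝ G rankWeight x * p x y ≤⟨ *-monoʳ-≤ _ (p-nonneg x y) (degree≤2 x) ⟩
      (1# + 1#) * p x y               ∎)
      where open ≤-Reasoning

  unit-nonnegative : Curvature.Nonnegative ℝ G rankWeight
  unit-nonnegative x~y = ≤-trans (≤-reflexive (≈-sym half+half≈1))
                                 (+-mono-≤ (half≤p x~y) (half≤p (~-sym x~y)))

-- Finite distortion and the classification

module _ (ℝ : Reals) (G : Graph) where
  open Reals ℝ hiding (zero)
  open OrderedField ℝ
  open Graph G

  finite-distortion : ∀ {x y} → x ~ y → (𝓌 : Weight ℝ G) → let open Weight 𝓌 in
    ∃[ b ] (0# < b × (∀ x y → b ≤ w x y)) → ∃[ c ] (∀ x y → w x y ≤ c) →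
    ∃[ r ] IsDistortion ℝ G 𝓌 [ r ]
  finite-distortion x~y 𝓌 (b , 0<b , b≤w) (c , w≤c) =
    let edgeWeight = _ , _ , _ , x~y , ≈-refl
        lower = λ { r (x , y , _ , r≈w) → ≤-trans (b≤w x y) (≤-reflexive (≈-sym r≈w)) }
        s , s-lub = complete (EdgeWeight ℝ G 𝓌) edgeWeight
          (c , λ { r (x , y , _ , r≈w) → ≤-trans (≤-reflexive r≈w) (w≤c x y) })
        i , i-glb = infimum (EdgeWeight ℝ G 𝓌) edgeWeight (b , lower)
    in s * i ⁻¹ , finite s-lub i-glb (<-≤-trans 0<b (proj₂ i-glb b lower))

  -- Zero serves as the lower bound from which `finite-DN` obtains its infimum; the positive weight
  -- of one edge keeps the supremum nonnegative.
  distortion-nonneg : ∀ {x y} → x ~ y → (𝓌 : Weight ℝ G) → ∀ {r} → IsDistortion ℝ G 𝓌 [ r ] → 0# ≤ r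
  distortion-nonneg x~y 𝓌 (finite (s-upper , _) _ 0<i) = *-nonneg
    (≤-trans (<⇒≤ (Weight.positive 𝓌 x~y)) (s-upper _ (_ , _ , x~y , ≈-refl)))
    (<⇒≤ (⁻¹-pos 0<i))

  0<∣E∣⇒edge : 0 ℕ.< ∣E∣ G → ∃[ x ] ∃[ y ] x ~ y
  0<∣E∣⇒edge 0<E with edges | all-filter (λ (x , y) → (x Fin.<? y) ×-dec (x ~? y))
                                  (List.cartesianProduct (List.allFin order) (List.allFin order))
  ... | (x , y) ∷ _ | (_ , x~y) ∷ _ = x , y , x~y

  module _ (conn : Connected G) where

    -- The infimum of the finite values is also the extended one: `⊤⁺` lies above every real, and it
    -- is no lower bound because the finite value `r` is attained.
    finite-DN : ∀ {x y} → x ~ y → (𝓌 : Weight ℝ G) → Admissible ℝ G conn 𝓌 →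
                ∃[ r ] IsDistortion ℝ G 𝓌 [ r ] → DN<∞ ℝ G conn
    finite-DN x~y 𝓌 admissible (r , distortion) =
      let Values = λ u → ∃[ 𝓌 ] (Admissible ℝ G conn 𝓌 × IsDistortion ℝ G 𝓌 [ u ])
          v , v-lower , v-greatest = infimum Values (r , 𝓌 , admissible , distortion)
            (0# , λ { _ (𝓌′ , _ , distortion′) → distortion-nonneg x~y 𝓌′ distortion′ })
      in v , nonempty (_ , _ , x~y)
           ( (λ { [ u ] value → AddSupremum.[ v-lower u value ]
                ; ⊤⁺    _     → AddSupremum._≤⊤⁺ [ v ] })
           , (λ { [ b ] lower → AddSupremum.[ v-greatest b (λ u value →
                                  AddSupremum.[≤]-injective _≤_ (lower [ u ] value)) ]
                ; ⊤⁺    lower → ⊥-elim (⊤⁺≰ (lower [ r ] (𝓌 , admissible , distortion))) }) )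
      where
      ⊤⁺≰ : ∀ {r} → ¬ ⊤⁺ ≤⁺ [ r ]
      ⊤⁺≰ ()

    edge? : Dec (∃[ x ] ∃[ y ] x ~ y)
    edge? = Fin.any? λ x → Fin.any? λ y → x ~? y

    edgeless⇒K₁ : ¬ (∃[ x ] ∃[ y ] x ~ y) → ∣V∣ G ≡ 1
    edgeless⇒K₁ edgeless = singleton (Connected.nonempty conn) λ x y →
      trivial (proj₂ (Connected.walk conn x y))
      where
      trivial : ∀ {k x y} → Walk k x y → x ≡ y
      trivial {zero}  x≡y           = x≡y
      trivial {suc k} (_ , x~z , _) = ⊥-elim (edgeless (_ , _ , x~z))
      singleton : ∀ {n} → Fin n → (∀ (x y : Fin n) → x ≡ y) → n ≡ 1
      singleton {suc zero}    _ _   = ≡.refl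
      singleton {suc (suc n)} _ all with () ← all zero (suc zero)

    module _ (girth : Girth≥ 6 G) where
      open Cycles G

      rank-DN<∞ : (rank : Vertex → ℕ) →
        (∀ {x y} → x ~ y → Curvature.Nonnegative ℝ G (RankWeight.rankWeight ℝ G rank)) →
        DN<∞ ℝ G conn
      rank-DN<∞ rank nonneg with edge?
      ... | no  edgeless      = 1# , K₁ (edgeless⇒K₁ edgeless)
      ... | yes (_ , _ , x~y) = finite-DN x~y rankWeight
          (Curvature.nonnegative⇒admissible ℝ G rankWeight conn girth (nonneg x~y))
          (finite-distortion x~y rankWeight rankWeight-bounds (1# , λ x y → ψ≤1 (rank x ℕ.⊔ rank y)))
        where open RankWeight ℝ G rank

      module _ (acyclic : ∀ n → ¬ HasCycle n G) where
        open RankWeight ℝ G (depth conn)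

        private
          open Transition ℝ G rankWeight using (p)

          tree-positive : ∀ {x y} → x ~ y → 1# < p x y + p y x
          tree-positive = unique-parent⇒positive-curvature (tree-parent-unique conn acyclic)

        tree⇒DN<∞ : DN<∞ ℝ G conn
        tree⇒DN<∞ = rank-DN<∞ (depth conn) λ _ x~y → <⇒≤ (tree-positive x~y)

        tree⇒∣E∣<∣V∣ : ∀ {x y} → x ~ y → ∣E∣ G ℕ.< ∣V∣ G
        tree⇒∣E∣<∣V∣ = positive⇒∣E∣<∣V∣ ℝ G rankWeight tree-positive

      cycle⇒DN<∞ : ∀ {n} → IsCycleGraph n G → DN<∞ ℝ G conn
      cycle⇒DN<∞ cycleGraph = rank-DN<∞ (λ _ → 0) λ _ → CycleWeight.unit-nonnegative ℝ G cycleGraph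

      -- Were there no admissible weight, `⊤⁺` would vacuously be a lower bound and the greatest one
      -- could not be finite. A weight itself cannot be extracted from the infimum, hence the double
      -- negation.
      none-admissible : ∀ {r x y} → x ~ y → IsDN ℝ G conn [ r ] → ¬ (∀ 𝓌 → ¬ Admissible ℝ G conn 𝓌)
      none-admissible x~y (K₁ order≡1) _ = collapse order≡1 x~y
        where
        collapse : order ≡ 1 → ∀ {x y} → ¬ x ~ y
        collapse order≡1 {x} {y} x~y = ~-irrefl (all-equal order≡1 x y) x~y
          where
          all-equal : ∀ {n} → n ≡ 1 → (x y : Fin n) → x ≡ y
          all-equal ≡.refl zero zero = ≡.refl
      none-admissible x~y (nonempty _ (_ , greatest)) none
        with () ← greatest ⊤⁺ (λ { _ (𝓌 , admissible , _) → ⊥-elim (none 𝓌 admissible) })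

      DN<∞⇒tree⊎cycle : DN<∞ ℝ G conn → IsTree G ⊎ (∃[ n ] (6 ℕ.≤ n × IsCycleGraph n G))
      DN<∞⇒tree⊎cycle (r , isDN) with anyCycle?
      ... | no  acyclic = inj₁ (conn , λ n cycle → acyclic (n , cycle))
      ... | yes (n , cycle@(3≤n , f , inj , hom)) =
        inj₂ (n , girth n cycle , saturated-cycle⇒cycleGraph conn 3≤n inj hom λ i {y} fi~y →
          -- Saturation is a finite search, so it may be proved by contradiction, and inside that
          -- contradiction an admissible weight may be assumed.
          decidable-stable
            (Fin.any? λ j → Graph._~?_ (C n 3≤n) i j ×-dec (f j Fin.≟ y))
            λ unsaturated → none-admissible fi~y isDN λ 𝓌 admissible → unsaturated
              (Curvature.cycle-saturated ℝ G 𝓌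
                (Curvature.admissible⇒nonnegative ℝ G 𝓌 conn girth admissible) 3≤n inj hom i fi~y))

open import Data.Nat using (_≤_; _<_)

corollary6p6 : (ℝ : Reals) (G : Graph) (conn : Connected G) → Girth≥ 6 G →
    (DN<∞ ℝ G conn ⇔ (IsTree G ⊎ ∃[ n ] (6 ≤ n × IsCycleGraph n G)))
    × (∣V∣ G < ∣E∣ G → DN≡∞ ℝ G conn)
    × (∣E∣ G ≡ ∣V∣ G → (DN<∞ ℝ G conn ⇔ (∃[ n ] (6 ≤ n × IsCycleGraph n G))))
corollary6p6 ℝ G conn girth =
    mk⇔ (DN<∞⇒tree⊎cycle ℝ G conn girth) (λ where
      (inj₁ (_ , acyclic))        → tree⇒DN<∞ ℝ G conn girth acyclic
      (inj₂ (_ , _ , cycleGraph)) → cycle⇒DN<∞ ℝ G conn girth cycleGraph)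
  -- Too many edges leave no admissible weight at all, so the infimum is over the empty set; the
  -- edge demanded by `nonempty` comes from `∣E∣` being positive.
  , (λ V<E → nonempty (0<∣E∣⇒edge ℝ G (ℕ.≤-<-trans ℕ.z≤n V<E))
      ( (λ { _ (𝓌 , admissible , _) → ⊥-elim (ℕ.<⇒≱ V<E (nonnegative⇒∣E∣≤∣V∣ ℝ G 𝓌
               (Curvature.admissible⇒nonnegative ℝ G 𝓌 conn girth admissible))) })
      , (λ b _ → AddSupremum._≤⊤⁺ b) ))
  , λ E≡V → mk⇔
      (λ DN<∞ → not-tree E≡V (DN<∞⇒tree⊎cycle ℝ G conn girth DN<∞))
      (λ { (_ , _ , cycleGraph) → cycle⇒DN<∞ ℝ G conn girth cycleGraph })
  where
  0<∣V∣ : 0 < ∣V∣ G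
  0<∣V∣ = ℕ.≤-<-trans ℕ.z≤n (Fin.toℕ<n (Connected.nonempty conn))
  -- A connected graph has a vertex, so `∣E∣ ≡ ∣V∣` provides an edge, and a tree with an edge has
  -- strictly fewer edges than vertices.
  not-tree : ∣E∣ G ≡ ∣V∣ G → IsTree G ⊎ (∃[ n ] (6 ≤ n × IsCycleGraph n G)) →
             ∃[ n ] (6 ≤ n × IsCycleGraph n G)
  not-tree E≡V (inj₂ cycle) = cycle
  not-tree E≡V (inj₁ (_ , acyclic))
    with _ , _ , x~y ← 0<∣E∣⇒edge ℝ G (≡.subst (0 <_) (≡.sym E≡V) 0<∣V∣) =
    ⊥-elim (ℕ.<-irrefl E≡V (tree⇒∣E∣<∣V∣ ℝ G conn girth acyclic x~y))
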